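{- Let $k\ge3$ and let $\tau\in\{12,\,21,\,1\mbox{ - }2\}$, so that $\tau\mbox{ - }3\mbox{ - }\cdots\mbox{ - }k$ is one of the generalized patterns $12\mbox{ - }3\mbox{ - }\cdots\mbox{ - }k$, $21\mbox{ - }3\mbox{ - }\cdots\mbox{ - }k$, $1\mbox{ - }2\mbox{ - }3\mbox{ - }\cdots\mbox{ - }k$. For $n\ge0$ let $ud(n)$ and $uu(n)$ be the numbers of up-down, respectively up-up, permutations of length $n$ that avoid $1\mbox{ - }3\mbox{ - }2$ and contain $\tau\mbox{ - }3\mbox{ - }\cdots\mbox{ - }k$ exactly once. Then (1) $\sum_{n\ge0}ud(n)x^n=\dfrac{x}{U_{k-1}^2\left(\frac1{2x}\right)}$; (2) $\sum_{n\ge0}uu(n)x^n=\dfrac{1}{U_{k-1}^2\left(\frac1{2x}\right)}$; (3) there is no up-down permutation and no up-up permutation that avoids $1\mbox{ - }3\mbox{ - }2$ and contains the classical pattern $2\mbox{ - }1\mbox{ - }3\mbox{ - }\cdots\mbox{ - }k$ exactly once (i.e. the corresponding generating functions are $0$).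
   Context: A permutation of length $n$ is a word $\pi_1\cdots\pi_n$ containing each of $1,\dots,n$ exactly once. Generalized patterns: a pattern is a permutation $\tau_1\cdots\tau_m$ written with some dashes between consecutive letters; an occurrence in $\pi$ is a tuple of indices $i_1<\dots<i_m$ such that $\pi_{i_1}\cdots\pi_{i_m}$ is order-isomorphic to $\tau_1\cdots\tau_m$ and such that $i_{j+1}=i_j+1$ whenever there is no dash between $\tau_j$ and $\tau_{j+1}$. Thus $1\mbox{ - }3\mbox{ - }2$ and $1\mbox{ - }2\mbox{ - }\cdots\mbox{ - }k$, $2\mbox{ - }1\mbox{ - }3\mbox{ - }\cdots\mbox{ - }k$ are classical patterns (arbitrary subsequences), while in $12\mbox{ - }3\mbox{ - }\cdots\mbox{ - }k$ and $21\mbox{ - }3\mbox{ - }\cdots\mbox{ - }k$ the first two letters must occupy adjacent positions. $\pi$ contains a pattern exactly $r$ times if it has exactly $r$ occurrences, and avoids it if $r=0$. For $n\ge2$: up-down permutations satisfy $\pi_1<\pi_2>\pi_3<\cdots$ with $n$ odd; up-up ones satisfy $\pi_1<\pi_2>\pi_3<\cdots$ with $n$ even; for $n=0,1$ there are none. $U_r$ is the Chebyshev polynomial of the second kind, $U_r(\cos\theta)=\sin((r+1)\theta)/\sin\theta$. -}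

module Defs where

open import Data.Nat as ℕ using (ℕ; zero; suc; _+_; _∸_; _<_; _≤_; _%_; _≤?_)
open import Data.Integer as ℤ using (ℤ; +_)
open import Data.Bool using (Bool; true; false)
open import Data.List using (List; []; _∷_; length; map; upTo; replicate)
open import Data.List.Membership.Propositional using (_∈_)
open import Data.List.Relation.Unary.Unique.Propositional using (Unique)
open import Data.List.Relation.Binary.Permutation.Propositional using (_↭_)
open import Data.Product using (Σ; _×_)
open import Function.Bundles using (_⇔_)
open import Relation.Binary.PropositionalEquality using (_≡_)
open import Relation.Nullary using (¬_; yes; no)

-- i-th letter of a word (0-indexed); default 0 outside the range
-- (only ever used with in-range indices below)
_!!_ : List ℕ → ℕ → ℕ
[] !! _ = 0
(x ∷ xs) !! zero = x
(x ∷ xs) !! suc i = xs !! i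

IsPerm : ℕ → List ℕ → Set
IsPerm n π = π ↭ map suc (upTo n)

Alternating : List ℕ → Set
Alternating π = ∀ j → suc j < length π →
  (j % 2 ≡ 0 → π !! j < π !! suc j) × (j % 2 ≡ 1 → π !! suc j < π !! j)

UpDown : ℕ → List ℕ → Set
UpDown n π = (2 ≤ n) × (n % 2 ≡ 1) × Alternating π

UpUp : ℕ → List ℕ → Set
UpUp n π = (2 ≤ n) × (n % 2 ≡ 0) × Alternating π

-- letters τ₁⋯τₘ (a permutation of 1..m) and flags adj, where
-- adj !! j = true means NO dash between τ_{j+1} and τ_{j+2} (1-indexed),
-- i.e. the corresponding positions of an occurrence must be adjacent.
record Pattern : Set where
  constructor mkPattern
  field
    letters : List ℕ
    adj     : List Bool
open Pattern public

bool!! : List Bool → ℕ → Bool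
bool!! [] _ = false
bool!! (b ∷ bs) zero = b
bool!! (b ∷ bs) (suc i) = bool!! bs i

Occurrence : Pattern → List ℕ → List ℕ → Set
Occurrence p π is =
  (length is ≡ length (letters p)) ×
  (∀ a → a < length is → is !! a < length π) ×
  (∀ a → suc a < length is → is !! a < is !! suc a) ×
  (∀ a b → a < length is → b < length is →
     (letters p !! a < letters p !! b) ⇔ (π !! (is !! a) < π !! (is !! b))) ×
  (∀ a → suc a < length is → bool!! (adj p) a ≡ true →
     is !! suc a ≡ suc (is !! a))

HasExactly : (List ℕ → Set) → ℕ → Set
HasExactly P c = Σ (List (List ℕ)) λ L →
  Unique L × (∀ x → (x ∈ L) ⇔ P x) × (length L ≡ c)

ContainsExactly : Pattern → List ℕ → ℕ → Set
ContainsExactly p π r = HasExactly (Occurrence p π) r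

Avoids : Pattern → List ℕ → Set
Avoids p π = ContainsExactly p π 0

p132 : Pattern
p132 = mkPattern (1 ∷ 3 ∷ 2 ∷ []) (false ∷ false ∷ [])

from3to : ℕ → List ℕ
from3to k = map (λ i → 3 + i) (upTo (k ∸ 2))

data Tau : Set where
  τ12 τ21 τ1-2 : Tau

tauPattern : Tau → ℕ → Pattern
tauPattern τ12  k = mkPattern (1 ∷ 2 ∷ from3to k) (true  ∷ replicate (k ∸ 2) false)
tauPattern τ21  k = mkPattern (2 ∷ 1 ∷ from3to k) (true  ∷ replicate (k ∸ 2) false)
tauPattern τ1-2 k = mkPattern (1 ∷ 2 ∷ from3to k) (false ∷ replicate (k ∸ 2) false)

p213k : ℕ → Pattern
p213k k = mkPattern (2 ∷ 1 ∷ from3to k) (false ∷ replicate (k ∸ 2) false)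

Series : Set
Series = ℕ → ℤ

sumTo : ℕ → (ℕ → ℤ) → ℤ
sumTo zero f = f 0
sumTo (suc n) f = sumTo n f ℤ.+ f (suc n)

_⊛_ : Series → Series → Series
(f ⊛ g) n = sumTo n (λ i → f i ℤ.* g (n ∸ i))

mono : ℤ → ℕ → Series
mono c m n with n ℕ.≟ m
... | yes _ = c
... | no  _ = + 0

ofℕ : (ℕ → ℕ) → Series
ofℕ a n = + (a n)

shiftT : Series → Series
shiftT f zero = + 0
shiftT f (suc i) = f i

chebU : ℕ → Series
chebU zero = mono (+ 1) 0
chebU (suc zero) = mono (+ 2) 1
chebU (suc (suc r)) i = (+ 2) ℤ.* shiftT (chebU (suc r)) i ℤ.- chebU r i

-- W_r(x) = (2x)^r · U_r(1/(2x)) = Σ_{j ≤ r} [t^{r-j}]U_r · 2^j · x^j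
chebW : ℕ → Series
chebW r j with j ≤? r
... | yes _ = chebU r (r ∸ j) ℤ.* (+ (2 ℕ.^ j))
... | no  _ = + 0

{-# OPTIONS --safe #-}

-- A 132-avoiding permutation splits around its maximum n as A n B with every letter of A above
-- every letter of B.  It is alternating exactly when |A| is odd and A, B are alternating, so the
-- odd-length ones are the full binary trees, and the even-length ones are the same trees with the
-- last letter 1 removed.  That letter never takes part in an occurrence of τ-3-⋯-k, hence
-- ud(n+1) = uu(n).
--
-- An occurrence of τ-3-⋯-k in A n B lies in A, lies in B, or consists of an occurrence of
-- τ-3-⋯-(k-1) in A followed by n.  A tree with at most one occurrence of τ-3-⋯-(k-1) has none of
-- τ-3-⋯-k.  So the generating functions Z_k (no occurrence) and P_k (exactly one) of the trees by
-- size satisfy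
--   Z_k = x + x Z_{k-1} Z_k,   P_k = x (P_{k-1} Z_k + Z_{k-1} P_k),   Z_2 = x,   P_2 = x³,
-- which W_{r+2} + 4x² W_r = 2 W_{r+1} turns into Z_k W_{k-1} = 2x W_{k-2} and
-- P_k W_{k-1}² = 4x² P_{k-1} W_{k-2}².
--
-- For 2-1-3-⋯-k the same decomposition holds, but the number of inversions of an odd-length word
-- is never 1, and a sum of natural numbers equals 1 only if one of the summands does.
module Submission where

open import Defs
open import Algebra.Bundles using (AbelianGroup; CommutativeSemiring)
open import Algebra.Structures.Biased using (isCommutativeSemiringˡ)
open import Data.Bool as Bool using (Bool; true; false)
open import Data.Empty using (⊥; ⊥-elim)
open import Data.Integer as ℤ using (ℤ; +_)
import Data.Integer.Properties as ℤP
open import Data.Integer.Tactic.RingSolver using (solve-∀)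
open import Data.List using (List; []; _∷_; length; map; _++_; _∷ʳ_; filter; cartesianProductWith; upTo; applyUpTo; replicate; initLast; _∷ʳ′_)
open import Data.List.Properties using (length-map; length-++; length-upTo; map-id; map-id-local; map-∘; map-++; map-injective; ∷-injective; ∷ʳ-injectiveˡ)
open import Data.List.Membership.Propositional using (_∈_; _∉_)
open import Data.List.Membership.Propositional.Properties
open import Data.List.Membership.Propositional.Properties.WithK using (unique∧set⇒bag)
open import Data.List.Relation.Binary.BagAndSetEquality using (∼bag⇒↭)
open import Data.List.Relation.Binary.Permutation.Propositional using (_↭_; ↭-sym; ↭⇒↭ₛ)
open import Data.List.Relation.Binary.Permutation.Propositional.Properties using (↭-length; ∈-resp-↭)
import Data.List.Relation.Binary.Permutation.Setoid.Properties as PermutationSetoid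
open import Data.List.Relation.Unary.All as All using (All; []; _∷_)
import Data.List.Relation.Unary.All.Properties as All
open import Data.List.Relation.Unary.AllPairs using ([]; _∷_)
open import Data.List.Relation.Unary.Any using (here; there)
open import Data.List.Relation.Unary.Unique.Propositional using (Unique)
import Data.List.Relation.Unary.Unique.Propositional.Properties as Unique
open import Data.Nat as ℕ using (ℕ; zero; suc; _+_; _*_; _∸_; _^_; _≤_; _<_; z≤n; s≤s; _≟_; _≤?_; _<?_; _%_)
import Data.Nat.Properties as ℕP
open import Data.Nat.Tactic.RingSolver using () renaming (solve-∀ to ℕ-solve-∀)
open import Data.Product using (Σ; ∃; ∃₂; _×_; _,_; proj₁; proj₂; map₁)
open import Data.Sum using (_⊎_; inj₁; inj₂; [_,_]′)
open import Function using (_∘_; id)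
open import Function.Bundles using (_⇔_; mk⇔; Equivalence)
open import Function.Properties.Equivalence using () renaming (sym to ⇔-sym; trans to ⇔-trans)
open import Level using (0ℓ)
open import Relation.Binary.Definitions using (tri<; tri≈; tri>)
open import Relation.Binary.PropositionalEquality as ≡ using (_≡_; _≢_; refl; sym; trans; cong; cong₂; subst; subst₂; module ≡-Reasoning)
open import Relation.Binary.Structures using (IsEquivalence)
open import Relation.Nullary using (¬_; Dec; yes; no; contradiction)
open import Relation.Nullary.Decidable using (_×-dec_; _→-dec_; map′)

open Equivalence using (to; from)

-- For k ≥ 3 each pattern ends in its largest letter. This gives the three kinds of occurrence in A
-- n B, and it makes a final letter 1 idle: as the last index of an occurrence it would have to
-- carry the largest letter. For k = 2 this fails (a descent can run from n into B), so that case is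
-- counted directly and only starts the recursion. The step from "at most one" to "none" comes from
-- alternation. Apart from the leaf and the tree with three vertices, whose word is 2 3 1, every
-- tree has length at least 5, hence two ascents and two descents. The word 2 3 1 has one occurrence
-- of each of 12, 21 and 1-2, which gives P_2 = x³, but two of 2-1. Z_k = x / (1 - x Z_{k-1}) is a
-- continued fraction. Up to powers of 2 its denominators are the W_r = (2x)^r U_r(1/(2x)), which is
-- how Chebyshev polynomials enter. Multiplying the claimed formulas by (2x)^{2(k-1)} turns them
-- into identities of power series without denominators, for instance ud · W_{k-1}² = x
-- (2x)^{2(k-1)}.

-- One step of the recurrences, in an abstract commutative semiring.

module RecurrenceStep {c ℓ} (R : CommutativeSemiring c ℓ) where

  open CommutativeSemiring R renaming (refl to ≈-refl; _+_ to infixl 6 _⊕_; _*_ to infixl 7 _⊗_)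
  open import Relation.Binary.Reasoning.Setoid setoid
  open import Algebra.Solver.Ring.NaturalCoefficients.Default R
    using (solve; _:=_; _:+_; _:*_)

  double : Carrier → Carrier
  double f = f ⊕ f

  double-cong : ∀ {f g} → f ≈ g → double f ≈ double g
  double-cong e = +-cong e e

  -- A semiring has no subtraction, so W″ = 2W′ - 4X²W appears as the sum `hW`, and additive
  -- cancellation does the work of subtracting. The names stand for three consecutive indices:
  -- plain, primed, double primed.
  module _ (cancelʳ : ∀ h {f g} → f ⊕ h ≈ g ⊕ h → f ≈ g) (X : Carrier) {Z Z′ W W′ W″ : Carrier}
    (hW : W″ ⊕ double (double (X ⊗ (X ⊗ W))) ≈ double W′)
    (hZ : Z ⊗ W′ ≈ double (X ⊗ W)) where

    -- Adding 4X²W·Z′ to the left side makes it 2W′·Z′ by `hW`. Expanding Z′ there and using `hZ` on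
    -- the factor Z·W′ produces 2X·W′ plus the same 4X²W·Z′, which cancels.
    zero-step : Z′ ≈ X ⊕ X ⊗ (Z ⊗ Z′) → Z′ ⊗ W″ ≈ double (X ⊗ W′)
    zero-step hZ′ = cancelʳ (double (double (X ⊗ (X ⊗ W))) ⊗ Z′) (begin
      Z′ ⊗ W″ ⊕ double (double (X ⊗ (X ⊗ W))) ⊗ Z′
        ≈⟨ solve 3 (λ z w v → z :* w :+ v :* z := (w :+ v) :* z) ≈-refl Z′ W″ _ ⟩
      (W″ ⊕ double (double (X ⊗ (X ⊗ W)))) ⊗ Z′
        ≈⟨ *-congʳ hW ⟩
      double W′ ⊗ Z′
        ≈⟨ *-congˡ hZ′ ⟩
      double W′ ⊗ (X ⊕ X ⊗ (Z ⊗ Z′))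
        ≈⟨ solve 4 (λ x z z′ w → (w :+ w) :* (x :+ x :* (z :* z′))
             := (x :* w :+ x :* w) :+ x :* ((z :* w) :+ (z :* w)) :* z′) ≈-refl X Z Z′ W′ ⟩
      double (X ⊗ W′) ⊕ (X ⊗ double (Z ⊗ W′)) ⊗ Z′
        ≈⟨ +-congˡ (*-congʳ (*-congˡ (double-cong hZ))) ⟩
      double (X ⊗ W′) ⊕ (X ⊗ double (double (X ⊗ W))) ⊗ Z′
        ≈⟨ solve 4 (λ x w z w′ → (x :* w′ :+ x :* w′) :+ x :* (x :* w :+ x :* w :+ (x :* w :+ x :* w)) :* z
             := (x :* w′ :+ x :* w′) :+ (x :* (x :* w) :+ x :* (x :* w) :+ (x :* (x :* w) :+ x :* (x :* w))) :* z)
             ≈-refl X W Z′ W′ ⟩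
      double (X ⊗ W′) ⊕ double (double (X ⊗ (X ⊗ W))) ⊗ Z′ ∎)

    -- The first factor W″ removes P′ from the right side of its own recurrence, by the cancellation
    -- used in `zero-step`, and leaves 2X·P·Z′·W′ (`half`). The second factor W″ then meets Z′ and
    -- turns it into 2X·W′.
    one-step : ∀ {P P′} → Z′ ≈ X ⊕ X ⊗ (Z ⊗ Z′) → P′ ≈ X ⊗ (P ⊗ Z′ ⊕ Z ⊗ P′) →
      (P′ ⊗ W″) ⊗ W″ ≈ double (double (X ⊗ (X ⊗ ((P ⊗ W′) ⊗ W′))))
    one-step {P} {P′} hZ′ hP′ = begin
      (P′ ⊗ W″) ⊗ W″
        ≈⟨ *-congʳ half ⟩
      (X ⊗ double ((P ⊗ Z′) ⊗ W′)) ⊗ W″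
        ≈⟨ solve 5 (λ x p z′ w′ w″ → x :* (p :* z′ :* w′ :+ p :* z′ :* w′) :* w″
             := x :* (p :* w′) :* (z′ :* w″) :+ x :* (p :* w′) :* (z′ :* w″)) ≈-refl X P Z′ W′ W″ ⟩
      double ((X ⊗ (P ⊗ W′)) ⊗ (Z′ ⊗ W″))
        ≈⟨ double-cong (*-congˡ (zero-step hZ′)) ⟩
      double ((X ⊗ (P ⊗ W′)) ⊗ double (X ⊗ W′))
        ≈⟨ double-cong (solve 3 (λ x p w → x :* (p :* w) :* (x :* w :+ x :* w)
             := x :* (x :* (p :* w :* w)) :+ x :* (x :* (p :* w :* w))) ≈-refl X P W′) ⟩
      double (double (X ⊗ (X ⊗ ((P ⊗ W′) ⊗ W′)))) ∎
      where
      half : P′ ⊗ W″ ≈ X ⊗ double ((P ⊗ Z′) ⊗ W′)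
      half = cancelʳ (double (double (X ⊗ (X ⊗ W))) ⊗ P′) (begin
        P′ ⊗ W″ ⊕ double (double (X ⊗ (X ⊗ W))) ⊗ P′
          ≈⟨ solve 3 (λ z w v → z :* w :+ v :* z := (w :+ v) :* z) ≈-refl P′ W″ _ ⟩
        (W″ ⊕ double (double (X ⊗ (X ⊗ W)))) ⊗ P′
          ≈⟨ *-congʳ hW ⟩
        double W′ ⊗ P′
          ≈⟨ *-congˡ hP′ ⟩
        double W′ ⊗ (X ⊗ (P ⊗ Z′ ⊕ Z ⊗ P′))
          ≈⟨ solve 6 (λ x z z′ p p′ w → (w :+ w) :* (x :* (p :* z′ :+ z :* p′))
               := x :* (p :* z′ :* w :+ p :* z′ :* w) :+ x :* (z :* w :+ z :* w) :* p′)
               ≈-refl X Z Z′ P P′ W′ ⟩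
        X ⊗ double ((P ⊗ Z′) ⊗ W′) ⊕ (X ⊗ double (Z ⊗ W′)) ⊗ P′
          ≈⟨ +-congˡ (*-congʳ (*-congˡ (double-cong hZ))) ⟩
        X ⊗ double ((P ⊗ Z′) ⊗ W′) ⊕ (X ⊗ double (double (X ⊗ W))) ⊗ P′
          ≈⟨ +-congˡ (solve 3 (λ x w z → x :* (x :* w :+ x :* w :+ (x :* w :+ x :* w)) :* z
               := (x :* (x :* w) :+ x :* (x :* w) :+ (x :* (x :* w) :+ x :* (x :* w))) :* z)
               ≈-refl X W P′) ⟩
        X ⊗ double ((P ⊗ Z′) ⊗ W′) ⊕ double (double (X ⊗ (X ⊗ W))) ⊗ P′ ∎)

-- Formal power series as a commutative semiring.

infix 4 _≈_
_≈_ : Series → Series → Set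
f ≈ g = ∀ n → f n ≡ g n

infixl 6 _⊞_
_⊞_ : Series → Series → Series
(f ⊞ g) n = f n ℤ.+ g n

scale : ℤ → Series → Series
scale c f n = c ℤ.* f n

tail : Series → Series
tail f n = f (suc n)

sumTo-cong : ∀ n {f g} → (∀ i → i ≤ n → f i ≡ g i) → sumTo n f ≡ sumTo n g
sumTo-cong zero    e = e 0 z≤n
sumTo-cong (suc n) e =
  cong₂ ℤ._+_ (sumTo-cong n λ i i≤n → e i (ℕP.m≤n⇒m≤1+n i≤n)) (e (suc n) ℕP.≤-refl)

sumTo-+ : ∀ n f g → sumTo n (λ i → f i ℤ.+ g i) ≡ sumTo n f ℤ.+ sumTo n g
sumTo-+ zero    f g = refl
sumTo-+ (suc n) f g rewrite sumTo-+ n f g = swap (sumTo n f) _ _ _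
  where
  swap : ∀ a b c d → (a ℤ.+ b) ℤ.+ (c ℤ.+ d) ≡ (a ℤ.+ c) ℤ.+ (b ℤ.+ d)
  swap = solve-∀

sumTo-scale : ∀ n c f → sumTo n (scale c f) ≡ c ℤ.* sumTo n f
sumTo-scale zero    c f = refl
sumTo-scale (suc n) c f rewrite sumTo-scale n c f = sym (ℤP.*-distribˡ-+ c _ _)

sumTo-head : ∀ n f → sumTo (suc n) f ≡ f 0 ℤ.+ sumTo n (tail f)
sumTo-head zero    f = refl
sumTo-head (suc n) f rewrite sumTo-head n f = ℤP.+-assoc (f 0) _ _

sumTo-reverse : ∀ n f → sumTo n f ≡ sumTo n (λ i → f (n ∸ i))
sumTo-reverse zero    f = refl
sumTo-reverse (suc n) f = begin
  sumTo n f ℤ.+ f (suc n)                     ≡⟨ cong (ℤ._+ f (suc n)) (sumTo-reverse n f) ⟩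
  sumTo n (λ i → f (n ∸ i)) ℤ.+ f (suc n)     ≡⟨ ℤP.+-comm _ (f (suc n)) ⟩
  f (suc n) ℤ.+ sumTo n (λ i → f (n ∸ i))     ≡⟨ sumTo-head n (λ i → f (suc n ∸ i)) ⟨
  sumTo (suc n) (λ i → f (suc n ∸ i))         ∎
  where open ≡-Reasoning

⊛-cong : ∀ {f f′ g g′} → f ≈ f′ → g ≈ g′ → f ⊛ g ≈ f′ ⊛ g′
⊛-cong p q n = sumTo-cong n λ i _ → cong₂ ℤ._*_ (p i) (q (n ∸ i))

⊛-comm : ∀ f g → f ⊛ g ≈ g ⊛ f
⊛-comm f g n = trans (sumTo-reverse n _) (sumTo-cong n λ i i≤n →
  trans (ℤP.*-comm (f (n ∸ i)) _) (cong (λ j → g j ℤ.* f (n ∸ i)) (ℕP.m∸[m∸n]≡n i≤n)))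

⊛-distribʳ : ∀ h f g → (f ⊞ g) ⊛ h ≈ (f ⊛ h) ⊞ (g ⊛ h)
⊛-distribʳ h f g n = trans
  (sumTo-cong n λ i _ → ℤP.*-distribʳ-+ (h (n ∸ i)) (f i) (g i)) (sumTo-+ n _ _)

⊛-scale : ∀ c f g → scale c f ⊛ g ≈ scale c (f ⊛ g)
⊛-scale c f g n = trans
  (sumTo-cong n λ i _ → ℤP.*-assoc c (f i) (g (n ∸ i))) (sumTo-scale n c _)

⊛-suc : ∀ f g n → (f ⊛ g) (suc n) ≡ f 0 ℤ.* g (suc n) ℤ.+ (tail f ⊛ g) n
⊛-suc f g n = sumTo-head n _

-- Induction on the index through f = f(0) + x · `tail f`. The tail of f ⊛ g is f(0) · `tail g` +
-- `tail f` ⊛ g, so the induction hypothesis is needed for `tail f` in place of f, at the smaller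
-- index.
⊛-assoc : ∀ f g h → (f ⊛ g) ⊛ h ≈ f ⊛ (g ⊛ h)
⊛-assoc f g h zero    = ℤP.*-assoc (f 0) (g 0) (h 0)
⊛-assoc f g h (suc n) = begin
  ((f ⊛ g) ⊛ h) (suc n)
    ≡⟨ ⊛-suc (f ⊛ g) h n ⟩
  a ℤ.* b ℤ.* c ℤ.+ (tail (f ⊛ g) ⊛ h) n
    ≡⟨ cong (λ u → a ℤ.* b ℤ.* c ℤ.+ u) (⊛-cong {g = h} (⊛-suc f g) (λ _ → refl) n) ⟩
  a ℤ.* b ℤ.* c ℤ.+ ((scale a (tail g) ⊞ (tail f ⊛ g)) ⊛ h) n
    ≡⟨ cong (λ u → a ℤ.* b ℤ.* c ℤ.+ u) (⊛-distribʳ h (scale a (tail g)) (tail f ⊛ g) n) ⟩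
  a ℤ.* b ℤ.* c ℤ.+ ((scale a (tail g) ⊛ h) n ℤ.+ ((tail f ⊛ g) ⊛ h) n)
    ≡⟨ cong (λ u → a ℤ.* b ℤ.* c ℤ.+ (u ℤ.+ ((tail f ⊛ g) ⊛ h) n)) (⊛-scale a (tail g) h n) ⟩
  a ℤ.* b ℤ.* c ℤ.+ (a ℤ.* (tail g ⊛ h) n ℤ.+ ((tail f ⊛ g) ⊛ h) n)
    ≡⟨ cong (λ u → a ℤ.* b ℤ.* c ℤ.+ (a ℤ.* (tail g ⊛ h) n ℤ.+ u)) (⊛-assoc (tail f) g h n) ⟩
  a ℤ.* b ℤ.* c ℤ.+ (a ℤ.* (tail g ⊛ h) n ℤ.+ (tail f ⊛ (g ⊛ h)) n)
    ≡⟨ regroup a b c _ _ ⟩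
  a ℤ.* (b ℤ.* c ℤ.+ (tail g ⊛ h) n) ℤ.+ (tail f ⊛ (g ⊛ h)) n
    ≡⟨ cong (λ u → a ℤ.* u ℤ.+ (tail f ⊛ (g ⊛ h)) n) (⊛-suc g h n) ⟨
  a ℤ.* (g ⊛ h) (suc n) ℤ.+ (tail f ⊛ (g ⊛ h)) n
    ≡⟨ ⊛-suc f (g ⊛ h) n ⟨
  (f ⊛ (g ⊛ h)) (suc n) ∎
  where
  open ≡-Reasoning
  a = f 0
  b = g 0
  c = h (suc n)
  regroup : ∀ a b c d e →
    a ℤ.* b ℤ.* c ℤ.+ (a ℤ.* d ℤ.+ e) ≡ a ℤ.* (b ℤ.* c ℤ.+ d) ℤ.+ e
  regroup = solve-∀

zeroS oneS X : Series
zeroS _ = + 0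
oneS = mono (+ 1) 0
X = mono (+ 1) 1

⊛-zeroˡ : ∀ f → zeroS ⊛ f ≈ zeroS
⊛-zeroˡ f zero    = refl
⊛-zeroˡ f (suc n) rewrite ⊛-zeroˡ f n = ℤP.*-zeroˡ (f 0)

mono-hit : ∀ c m → mono c m m ≡ c
mono-hit c m with m ℕ.≟ m
... | yes _ = refl
... | no m≢m = contradiction refl m≢m

mono-miss : ∀ c {m n} → n ≢ m → mono c m n ≡ + 0
mono-miss c {m} {n} n≢m with n ℕ.≟ m
... | yes n≡m = contradiction n≡m n≢m
... | no _ = refl

tail-mono : ∀ c m → tail (mono c (suc m)) ≈ mono c m
tail-mono c m n with n ℕ.≟ m
... | yes refl = mono-hit c (suc m)
... | no n≢m = mono-miss c (λ e → n≢m (ℕP.suc-injective e))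

⊛-identityˡ : ∀ f → oneS ⊛ f ≈ f
⊛-identityˡ f zero    = ℤP.*-identityˡ (f 0)
⊛-identityˡ f (suc n) = begin
  (oneS ⊛ f) (suc n)                      ≡⟨ ⊛-suc oneS f n ⟩
  + 1 ℤ.* f (suc n) ℤ.+ (zeroS ⊛ f) n     ≡⟨ cong₂ ℤ._+_ (ℤP.*-identityˡ (f (suc n))) (⊛-zeroˡ f n) ⟩
  f (suc n) ℤ.+ + 0                       ≡⟨ ℤP.+-identityʳ _ ⟩
  f (suc n)                               ∎
  where open ≡-Reasoning

X-⊛ : ∀ f → X ⊛ f ≈ shiftT f
X-⊛ f zero    = refl
X-⊛ f (suc n) = begin
  (X ⊛ f) (suc n)                        ≡⟨ ⊛-suc X f n ⟩
  + 0 ℤ.* f (suc n) ℤ.+ (tail X ⊛ f) n   ≡⟨ ℤP.+-identityˡ _ ⟩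
  (tail X ⊛ f) n                         ≡⟨ ⊛-cong {g = f} (tail-mono (+ 1) 0) (λ _ → refl) n ⟩
  (oneS ⊛ f) n                           ≡⟨ ⊛-identityˡ f n ⟩
  f n                                    ∎
  where open ≡-Reasoning

≈-isEquivalence : IsEquivalence _≈_
≈-isEquivalence = record
  { refl  = λ _ → refl
  ; sym   = λ p n → sym (p n)
  ; trans = λ p q n → trans (p n) (q n)
  }

seriesSemiring : CommutativeSemiring 0ℓ 0ℓ
seriesSemiring = record
  { Carrier = Series
  ; _≈_ = _≈_
  ; _+_ = _⊞_
  ; _*_ = _⊛_
  ; 0# = zeroS
  ; 1# = oneS
  ; isCommutativeSemiring = isCommutativeSemiringˡ (record
      { +-isCommutativeMonoid = record
          { isMonoid = record
              { isSemigroup = record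
                  { isMagma = record
                      { isEquivalence = ≈-isEquivalence
                      ; ∙-cong = λ p q n → cong₂ ℤ._+_ (p n) (q n) }
                  ; assoc = λ f g h n → ℤP.+-assoc (f n) (g n) (h n) }
              ; identity = (λ f n → ℤP.+-identityˡ (f n)) , (λ f n → ℤP.+-identityʳ (f n)) }
          ; comm = λ f g n → ℤP.+-comm (f n) (g n) }
      ; *-isCommutativeMonoid = record
          { isMonoid = record
              { isSemigroup = record
                  { isMagma = record
                      { isEquivalence = ≈-isEquivalence
                      ; ∙-cong = ⊛-cong }
                  ; assoc = ⊛-assoc }
              ; identity = ⊛-identityˡ , λ f n → trans (⊛-comm f oneS n) (⊛-identityˡ f n) }
          ; comm = ⊛-comm }
      ; distribʳ = ⊛-distribʳ
      ; zeroˡ = ⊛-zeroˡ })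
  }

⊞-cancelʳ : ∀ h {f g} → f ⊞ h ≈ g ⊞ h → f ≈ g
⊞-cancelʳ h e n = ∙-cancelʳ (h n) _ _ (e n)
  where open import Algebra.Properties.Group (AbelianGroup.group ℤP.+-0-abelianGroup) using (∙-cancelʳ)

-- The rescaled Chebyshev polynomials W_r.

chebU-degree : ∀ r i → r < i → chebU r i ≡ + 0
chebU-degree zero (suc i) _ = refl
chebU-degree (suc zero) i 1<i = mono-miss (+ 2) (ℕP.>⇒≢ 1<i)
chebU-degree (suc (suc r)) (suc i) (s≤s r<i)
  rewrite chebU-degree (suc r) i r<i | chebU-degree r (suc i) (ℕP.m≤n⇒m≤1+n (ℕP.<-trans (ℕP.n<1+n r) r<i)) = refl

chebW-≤ : ∀ {r j} → j ≤ r → chebW r j ≡ chebU r (r ∸ j) ℤ.* + (2 ℕ.^ j)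
chebW-≤ {r} {j} j≤r with j ≤? r
... | yes _ = refl
... | no j≰r = contradiction j≤r j≰r

chebW-> : ∀ {r j} → r < j → chebW r j ≡ + 0
chebW-> {r} {j} r<j with j ≤? r
... | yes j≤r = contradiction r<j (ℕP.≤⇒≯ j≤r)
... | no _ = refl

-- This is U_{r+2} = 2t U_{r+1} - U_r with the coefficients read from the top degree down; a drop of
-- two in degree becomes a factor (2x)². At indices 0 and 1 the shifted term is absent, and
-- correspondingly U_r has no coefficient in degrees r + 2 and r + 1.
chebW-rec : ∀ r → chebW (suc (suc r)) ⊞ scale (+ 4) (shiftT (shiftT (chebW r)))
                ≈ scale (+ 2) (chebW (suc r))
chebW-rec r zero = begin
  chebW (2 ℕ.+ r) 0 ℤ.+ + 0
    ≡⟨ ℤP.+-identityʳ _ ⟩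
  chebW (2 ℕ.+ r) 0
    ≡⟨ chebW-≤ {2 ℕ.+ r} {0} z≤n ⟩
  (+ 2 ℤ.* u ℤ.- chebU r (2 ℕ.+ r)) ℤ.* + 1
    ≡⟨ cong (λ z → (+ 2 ℤ.* u ℤ.- z) ℤ.* + 1) (chebU-degree r _ (ℕP.m≤n⇒m≤1+n (ℕP.n<1+n r))) ⟩
  (+ 2 ℤ.* u ℤ.- + 0) ℤ.* + 1
    ≡⟨ lem u ⟩
  + 2 ℤ.* (u ℤ.* + 1)
    ≡⟨ cong (+ 2 ℤ.*_) (chebW-≤ {1 ℕ.+ r} {0} z≤n) ⟨
  + 2 ℤ.* chebW (1 ℕ.+ r) 0 ∎
  where
  open ≡-Reasoning
  u = chebU (suc r) (suc r)
  lem : ∀ u → (+ 2 ℤ.* u ℤ.- + 0) ℤ.* + 1 ≡ + 2 ℤ.* (u ℤ.* + 1)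
  lem = solve-∀
chebW-rec r (suc zero) = begin
  chebW (2 ℕ.+ r) 1 ℤ.+ + 0
    ≡⟨ ℤP.+-identityʳ _ ⟩
  chebW (2 ℕ.+ r) 1
    ≡⟨ chebW-≤ {2 ℕ.+ r} {1} (s≤s z≤n) ⟩
  (+ 2 ℤ.* u ℤ.- chebU r (1 ℕ.+ r)) ℤ.* + 2
    ≡⟨ cong (λ z → (+ 2 ℤ.* u ℤ.- z) ℤ.* + 2) (chebU-degree r _ (ℕP.n<1+n r)) ⟩
  (+ 2 ℤ.* u ℤ.- + 0) ℤ.* + 2
    ≡⟨ lem u ⟩
  + 2 ℤ.* (u ℤ.* + 2)
    ≡⟨ cong (+ 2 ℤ.*_) (chebW-≤ {1 ℕ.+ r} {1} (s≤s z≤n)) ⟨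
  + 2 ℤ.* chebW (1 ℕ.+ r) 1 ∎
  where
  open ≡-Reasoning
  u = chebU (suc r) r
  lem : ∀ u → (+ 2 ℤ.* u ℤ.- + 0) ℤ.* + 2 ≡ + 2 ℤ.* (u ℤ.* + 2)
  lem = solve-∀
chebW-rec r (suc (suc j)) with j ≤? r
... | no j≰r rewrite chebW-> {2 ℕ.+ r} {2 ℕ.+ j} (s≤s (s≤s (ℕP.≰⇒> j≰r)))
      | chebW-> {1 ℕ.+ r} {2 ℕ.+ j} (s≤s (ℕP.m≤n⇒m≤1+n (ℕP.≰⇒> j≰r))) = refl
... | yes j≤r = begin
  chebW (2 ℕ.+ r) (2 ℕ.+ j) ℤ.+ + 4 ℤ.* (u ℤ.* p)
    ≡⟨ cong (λ z → z ℤ.+ + 4 ℤ.* (u ℤ.* p)) (chebW-≤ {2 ℕ.+ r} {2 ℕ.+ j} (s≤s (s≤s j≤r))) ⟩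
  (+ 2 ℤ.* v ℤ.- u) ℤ.* q ℤ.+ + 4 ℤ.* (u ℤ.* p)
    ≡⟨ cong (λ z → (+ 2 ℤ.* v ℤ.- u) ℤ.* z ℤ.+ + 4 ℤ.* (u ℤ.* p)) q≡4p ⟩
  (+ 2 ℤ.* v ℤ.- u) ℤ.* (+ 2 ℤ.* (+ 2 ℤ.* p)) ℤ.+ + 4 ℤ.* (u ℤ.* p)
    ≡⟨ lem v u p ⟩
  + 2 ℤ.* (v ℤ.* (+ 2 ℤ.* (+ 2 ℤ.* p)))
    ≡⟨ cong (λ z → + 2 ℤ.* (v ℤ.* z)) q≡4p ⟨
  + 2 ℤ.* (v ℤ.* q)
    ≡⟨ cong (λ z → + 2 ℤ.* z) (shifted r j≤r) ⟨
  + 2 ℤ.* chebW (1 ℕ.+ r) (2 ℕ.+ j) ∎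
  where
  open ≡-Reasoning
  u = chebU r (r ∸ j)
  v = shiftT (chebU (suc r)) (r ∸ j)
  p = + (2 ℕ.^ j)
  q = + (2 ℕ.^ (2 ℕ.+ j))
  q≡4p : q ≡ + 2 ℤ.* (+ 2 ℤ.* p)
  q≡4p = trans (ℤP.pos-* 2 (2 ℕ.^ (1 ℕ.+ j))) (cong (λ z → + 2 ℤ.* z) (ℤP.pos-* 2 (2 ℕ.^ j)))
  shifted : ∀ r → j ≤ r → chebW (1 ℕ.+ r) (2 ℕ.+ j) ≡ shiftT (chebU (suc r)) (r ∸ j) ℤ.* q
  shifted r j≤r with ℕP.m≤n⇒m<n∨m≡n j≤r
  -- For j = r both sides are 0: `shiftT` starts with 0, and index r + 2 lies beyond the degree r +
  -- 1 of `chebW (1 + r)`.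
  ... | inj₂ refl rewrite ℕP.n∸n≡0 r = chebW-> {1 ℕ.+ r} {2 ℕ.+ r} ℕP.≤-refl
  shifted (suc r) _ | inj₁ (s≤s j≤r) rewrite ℕP.+-∸-assoc 1 j≤r =
    chebW-≤ {2 ℕ.+ r} {2 ℕ.+ j} (s≤s (s≤s j≤r))
  lem : ∀ v u p → (+ 2 ℤ.* v ℤ.- u) ℤ.* (+ 2 ℤ.* (+ 2 ℤ.* p)) ℤ.+ + 4 ℤ.* (u ℤ.* p)
                ≡ + 2 ℤ.* (v ℤ.* (+ 2 ℤ.* (+ 2 ℤ.* p)))
  lem = solve-∀

two : Series → Series
two f = f ⊞ f

chebW-recX : ∀ r → chebW (suc (suc r)) ⊞ two (two (X ⊛ (X ⊛ chebW r))) ≈ two (chebW (suc r))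
chebW-recX r n = begin
  w″ ℤ.+ ((x ℤ.+ x) ℤ.+ (x ℤ.+ x))   ≡⟨ cong (λ u → w″ ℤ.+ u) (four x) ⟩
  w″ ℤ.+ + 4 ℤ.* x                   ≡⟨ cong (λ u → w″ ℤ.+ + 4 ℤ.* u) XX ⟩
  w″ ℤ.+ + 4 ℤ.* shiftT (shiftT (chebW r)) n ≡⟨ chebW-rec r n ⟩
  + 2 ℤ.* chebW (suc r) n            ≡⟨ double (chebW (suc r) n) ⟩
  two (chebW (suc r)) n              ∎
  where
  open ≡-Reasoning
  w″ = chebW (suc (suc r)) n
  x = (X ⊛ (X ⊛ chebW r)) n
  XX : x ≡ shiftT (shiftT (chebW r)) n
  XX = trans (⊛-cong {f = X} (λ _ → refl) (X-⊛ (chebW r)) n) (X-⊛ (shiftT (chebW r)) n)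
  four : ∀ x → (x ℤ.+ x) ℤ.+ (x ℤ.+ x) ≡ + 4 ℤ.* x
  four = solve-∀
  double : ∀ x → + 2 ℤ.* x ≡ x ℤ.+ x
  double = solve-∀

open RecurrenceStep seriesSemiring using (zero-step; one-step)

two-cong : ∀ {f g} → f ≈ g → two f ≈ two g
two-cong e n = cong₂ ℤ._+_ (e n) (e n)

X-cong : ∀ {f g} → f ≈ g → X ⊛ f ≈ X ⊛ g
X-cong {f} {g} e = ⊛-cong {X} {X} {f} {g} (λ _ → refl) e

X-mono : ∀ c m → X ⊛ mono c m ≈ mono c (suc m)
X-mono c m n = trans (X-⊛ (mono c m) n) (shift n)
  where
  shift : ∀ n → shiftT (mono c m) n ≡ mono c (suc m) n
  shift zero    = refl
  shift (suc n) = sym (tail-mono c m n)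

mono-+ : ∀ c d m → mono c m ⊞ mono d m ≈ mono (c ℤ.+ d) m
mono-+ c d m n with n ℕ.≟ m
... | yes _ = refl
... | no _ = refl

-- The recurrences solve to zs e = 2X·W_e/W_{e+1} and ps e = X·(2X)^{2e+2}/W_{e+1}²; here k = 2 + e.
module _ (zs ps : ℕ → Series)
  (zs-base : zs 0 ≈ X) (ps-base : ps 0 ≈ mono (+ 1) 3)
  (zs-rec : ∀ e → zs (suc e) ≈ X ⊞ X ⊛ (zs e ⊛ zs (suc e)))
  (ps-rec : ∀ e → ps (suc e) ≈ X ⊛ (ps e ⊛ zs (suc e) ⊞ zs e ⊛ ps (suc e))) where

  open import Relation.Binary.Reasoning.Setoid (CommutativeSemiring.setoid seriesSemiring)
  open import Algebra.Solver.Ring.NaturalCoefficients.Default seriesSemiring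
    using (solve; _:=_; _:+_; _:*_)

  W₀ : chebW 0 ≈ oneS
  W₀ zero    = refl
  W₀ (suc n) = refl

  W₁ : chebW 1 ≈ two oneS
  W₁ zero          = refl
  W₁ (suc zero)    = refl
  W₁ (suc (suc n)) = refl

  zs-closed : ∀ e → zs e ⊛ chebW (suc e) ≈ two (X ⊛ chebW e)
  zs-closed zero = begin
    zs 0 ⊛ chebW 1         ≈⟨ ⊛-cong {zs 0} {X} zs-base W₁ ⟩
    X ⊛ two oneS           ≈⟨ solve 2 (λ x y → x :* (y :+ y) := x :* y :+ x :* y) (λ _ → refl) X oneS ⟩
    two (X ⊛ oneS)         ≈⟨ two-cong (X-cong {chebW 0} {oneS} W₀) ⟨
    two (X ⊛ chebW 0)      ∎
  zs-closed (suc e) = zero-step ⊞-cancelʳ X {zs e} {zs (suc e)} {chebW e} {chebW (suc e)} {chebW (2 ℕ.+ e)}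
    (chebW-recX e) (zs-closed e) (zs-rec e)

  -- The base case is X³ · 2 · 2, since W_1 is the constant 2. Each further step of `one-step`
  -- contributes a factor (2X)², that is, 4 in the coefficient and 2 in the degree.
  ps-closed : ∀ e → (ps e ⊛ chebW (suc e)) ⊛ chebW (suc e)
                  ≈ mono (+ (2 ℕ.^ (2 ℕ.* suc e))) (suc (2 ℕ.* suc e))
  ps-closed zero = begin
    (ps 0 ⊛ chebW 1) ⊛ chebW 1
      ≈⟨ ⊛-cong {ps 0 ⊛ chebW 1} (⊛-cong {ps 0} ps-base W₁) W₁ ⟩
    (mono (+ 1) 3 ⊛ two oneS) ⊛ two oneS
      ≈⟨ solve 2 (λ x y → x :* (y :+ y) :* (y :+ y)
           := y :* (y :* x) :+ y :* (y :* x) :+ (y :* (y :* x) :+ y :* (y :* x)))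
           (λ _ → refl) (mono (+ 1) 3) oneS ⟩
    two (two (oneS ⊛ (oneS ⊛ mono (+ 1) 3)))
      ≈⟨ two-cong (two-cong λ n → trans (⊛-identityˡ (oneS ⊛ mono (+ 1) 3) n) (⊛-identityˡ (mono (+ 1) 3) n)) ⟩
    two (two (mono (+ 1) 3))
      ≈⟨ (λ n → trans (two-cong (mono-+ (+ 1) (+ 1) 3) n) (mono-+ (+ 2) (+ 2) 3 n)) ⟩
    mono (+ 4) 3 ∎
  ps-closed (suc e) = begin
    (ps (suc e) ⊛ chebW (2 ℕ.+ e)) ⊛ chebW (2 ℕ.+ e)
      ≈⟨ one-step ⊞-cancelʳ X {zs e} {zs (suc e)} {chebW e} {chebW (suc e)} {chebW (2 ℕ.+ e)}
           (chebW-recX e) (zs-closed e) {ps e} {ps (suc e)} (zs-rec e) (ps-rec e) ⟩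
    two (two (X ⊛ (X ⊛ ((ps e ⊛ chebW (suc e)) ⊛ chebW (suc e)))))
      ≈⟨ two-cong (two-cong (X-cong (X-cong (ps-closed e)))) ⟩
    two (two (X ⊛ (X ⊛ mono (+ c) m)))
      ≈⟨ two-cong (two-cong λ n → trans (X-cong (X-mono (+ c) m) n) (X-mono (+ c) (suc m) n)) ⟩
    two (two (mono (+ c) (2 ℕ.+ m)))
      ≈⟨ (λ n → trans (two-cong (mono-+ (+ c) (+ c) (2 ℕ.+ m)) n)
             (mono-+ (+ (c ℕ.+ c)) (+ (c ℕ.+ c)) (2 ℕ.+ m) n)) ⟩
    mono (+ ((c ℕ.+ c) ℕ.+ (c ℕ.+ c))) (2 ℕ.+ m)
      ≡⟨ cong₂ (λ a b → mono (+ a) b) coefficient degree ⟩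
    mono (+ (2 ℕ.^ (2 ℕ.* suc (suc e)))) (suc (2 ℕ.* suc (suc e))) ∎
    where
    c = 2 ℕ.^ (2 ℕ.* suc e)
    m = suc (2 ℕ.* suc e)
    degree : 2 ℕ.+ m ≡ suc (2 ℕ.* suc (suc e))
    degree = cong suc (sym (ℕP.*-suc 2 (suc e)))
    coefficient : (c ℕ.+ c) ℕ.+ (c ℕ.+ c) ≡ 2 ℕ.^ (2 ℕ.* suc (suc e))
    coefficient = trans (four c) (cong (2 ℕ.^_) (sym (ℕP.*-suc 2 (suc e))))
      where
      four : ∀ c → (c ℕ.+ c) ℕ.+ (c ℕ.+ c) ≡ 2 ℕ.* (2 ℕ.* c)
      four = ℕ-solve-∀

-- Counting by duplicate-free lists.

-- HasExactly for predicates on an arbitrary type.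
Card : {A : Set} → (A → Set) → ℕ → Set
Card {A} P c = Σ (List A) λ L →
  Unique L × (∀ x → (x ∈ L) ⇔ P x) × (length L ≡ c)

unique∧set⇒↭ : {A : Set} {xs ys : List A} → Unique xs → Unique ys →
  (∀ x → (x ∈ xs) ⇔ (x ∈ ys)) → xs ↭ ys
unique∧set⇒↭ u v e = ∼bag⇒↭ (unique∧set⇒bag u v (e _))

module _ {A : Set} where

  card-resp : {P Q : A → Set} {c : ℕ} → (∀ x → P x ⇔ Q x) → Card P c → Card Q c
  card-resp e (L , u , m , l) = L , u , (λ x → ⇔-trans (m x) (e x)) , l

  -- Two duplicate-free lists with the same members are permutations of each other. Every later
  -- equation between counts comes from here: the same objects are listed in two ways.
  card-unique : {P Q : A → Set} {c d : ℕ} → (∀ x → P x ⇔ Q x) → Card P c → Card Q d → c ≡ d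
  card-unique e (L , u , m , refl) (L′ , u′ , m′ , refl) =
    ↭-length (unique∧set⇒↭ u u′ λ x → ⇔-trans (m x) (⇔-trans (e x) (⇔-sym (m′ x))))

  card-⊎ : {P Q : A → Set} {c d : ℕ} → (∀ x → P x → ¬ Q x) →
    Card P c → Card Q d → Card (λ x → P x ⊎ Q x) (c + d)
  card-⊎ disjoint (L , u , m , refl) (L′ , u′ , m′ , refl) =
    L ++ L′ ,
    Unique.++⁺ u u′ (λ (x∈L , x∈L′) → disjoint _ (to (m _) x∈L) (to (m′ _) x∈L′)) ,
    (λ x → mk⇔
      ([ inj₁ ∘ to (m x) , inj₂ ∘ to (m′ x) ]′ ∘ ∈-++⁻ L)
      [ ∈-++⁺ˡ ∘ from (m x) , ∈-++⁺ʳ L ∘ from (m′ x) ]′) ,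
    length-++ L

  card-image : {B : Set} {P : A → Set} {c : ℕ} (f : A → B) → (∀ {x y} → f x ≡ f y → x ≡ y) →
    Card P c → Card (λ y → ∃ λ x → P x × y ≡ f x) c
  card-image f inj (L , u , m , refl) =
    map f L , Unique.map⁺ inj u ,
    (λ y → mk⇔
      (λ y∈ → let x , x∈ , e = ∈-map⁻ f y∈ in x , to (m x) x∈ , e)
      (λ { (x , px , refl) → ∈-map⁺ f (from (m x) px) })) ,
    length-map f L

  card-filter : {P Q : A → Set} {c : ℕ} → (∀ x → Dec (Q x)) → Card P c →
    ∃ λ d → Card (λ x → P x × Q x) d
  card-filter Q? (L , u , m , _) =
    _ , filter Q? L , Unique.filter⁺ Q? u ,
    (λ x → mk⇔
      (λ x∈ → let x∈L , qx = ∈-filter⁻ Q? x∈ in to (m x) x∈L , qx)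
      (λ (px , qx) → ∈-filter⁺ Q? (from (m x) px) qx)) ,
    refl

  card-empty : {P : A → Set} → (∀ x → ¬ P x) → Card P 0
  card-empty ¬P = [] , [] , (λ x → mk⇔ (λ ()) (⊥-elim ∘ ¬P x)) , refl

  card-singleton : {P : A → Set} (a : A) → (∀ x → P x ⇔ x ≡ a) → Card P 1
  card-singleton a e = a ∷ [] , [] ∷ [] ,
    (λ x → mk⇔ (λ { (here x≡a) → from (e x) x≡a ; (there ()) }) (here ∘ to (e x))) , refl

  card-≥2 : {P : A → Set} {c : ℕ} {x y : A} → x ≢ y → P x → P y → Card P c → 2 ≤ c
  card-≥2 {x = x} {y} x≢y px py (L , u , m , refl) with L | from (m x) px | from (m y) py
  ... | _ ∷ []    | here refl | here refl = contradiction refl x≢y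
  ... | _ ∷ _ ∷ _ | _         | _         = s≤s (s≤s z≤n)

length-cartesianProductWith : {A B C : Set} (f : A → B → C) (xs : List A) (ys : List B) →
  length (cartesianProductWith f xs ys) ≡ length xs * length ys
length-cartesianProductWith f []       ys = refl
length-cartesianProductWith f (x ∷ xs) ys = begin
  length (map (f x) ys ++ cartesianProductWith f xs ys)
    ≡⟨ length-++ (map (f x) ys) ⟩
  length (map (f x) ys) + length (cartesianProductWith f xs ys)
    ≡⟨ cong₂ _+_ (length-map (f x) ys) (length-cartesianProductWith f xs ys) ⟩
  length ys + length xs * length ys ∎
  where open ≡-Reasoning

card-product : {A B C : Set} {P : A → Set} {Q : B → Set} {c d : ℕ} (f : A → B → C) →
  (∀ {w x y z} → f w y ≡ f x z → w ≡ x × y ≡ z) → Card P c → Card Q d →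
  Card (λ z → ∃₂ λ x y → z ≡ f x y × P x × Q y) (c * d)
card-product f inj (L , u , m , refl) (L′ , u′ , m′ , refl) =
  cartesianProductWith f L L′ , Unique.cartesianProductWith⁺ f inj u u′ ,
  (λ z → mk⇔
    (λ z∈ → let x , y , x∈ , y∈ , e = ∈-cartesianProductWith⁻ f L L′ z∈
            in x , y , e , to (m x) x∈ , to (m′ y) y∈)
    (λ { (x , y , refl , px , qy) → ∈-cartesianProductWith⁺ f (from (m x) px) (from (m′ y) qy) })) ,
  length-cartesianProductWith f L L′

-- Full binary trees and the convolution of their counts.

data Tree : Set where
  leaf : Tree
  node : Tree → Tree → Tree

size : Tree → ℕ
size leaf       = 1
size (node s t) = suc (size s + size t)

node-injective : ∀ {s s′ t t′} → node s t ≡ node s′ t′ → s ≡ s′ × t ≡ t′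
node-injective refl = refl , refl

-- The bound is on the height, counted in vertices, so that the recursion is a plain product. Height
-- never exceeds size, so all trees of size at most `n` are listed, along with larger ones that
-- `countOfSize` filters out.
treesUpTo : ℕ → List Tree
treesUpTo zero    = []
treesUpTo (suc n) = leaf ∷ cartesianProductWith node (treesUpTo n) (treesUpTo n)

leaf≢node : ∀ {s t} → leaf ≢ node s t
leaf≢node ()

treesUpTo-unique : ∀ n → Unique (treesUpTo n)
treesUpTo-unique zero    = []
treesUpTo-unique (suc n) = Unique.++⁺ {xs = leaf ∷ []} ([] ∷ [])
  (Unique.cartesianProductWith⁺ node node-injective (treesUpTo-unique n) (treesUpTo-unique n))
  λ { (here refl , z∈) →
      let _ , _ , _ , _ , e = ∈-cartesianProductWith⁻ node (treesUpTo n) (treesUpTo n) z∈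
      in leaf≢node e }

treesUpTo-complete : ∀ n t → size t ≤ n → t ∈ treesUpTo n
treesUpTo-complete (suc n) leaf       _         = here refl
treesUpTo-complete (suc n) (node s t) (s≤s s+t≤n) = there (∈-cartesianProductWith⁺ node
  (treesUpTo-complete n s (ℕP.m+n≤o⇒m≤o (size s) s+t≤n))
  (treesUpTo-complete n t (ℕP.m+n≤o⇒n≤o (size s) s+t≤n)))

module _ (A : Tree → Set) (A? : ∀ t → Dec (A t)) where

  countOfSize : ℕ → ℕ
  countOfSize n = length (filter (λ t → (size t ≟ n) ×-dec A? t) (treesUpTo n))

  countOfSize-card : ∀ n → Card (λ t → size t ≡ n × A t) (countOfSize n)
  countOfSize-card n = filter Q? (treesUpTo n) , Unique.filter⁺ Q? (treesUpTo-unique n) ,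
    (λ t → mk⇔ (proj₂ ∘ ∈-filter⁻ Q? {xs = treesUpTo n})
      (λ q → ∈-filter⁺ Q? (treesUpTo-complete n t (ℕP.≤-reflexive (proj₁ q))) q)) ,
    refl
    where Q? = λ t → (size t ≟ n) ×-dec A? t

sumToℕ : ℕ → (ℕ → ℕ) → ℕ
sumToℕ zero    f = f 0
sumToℕ (suc n) f = sumToℕ n f + f (suc n)

sumToℕ-sumTo : ∀ n f → + sumToℕ n f ≡ sumTo n (λ i → + f i)
sumToℕ-sumTo zero    f = refl
sumToℕ-sumTo (suc n) f rewrite sym (sumToℕ-sumTo n f) = refl

module _ {A B : Tree → Set} {α β : ℕ → ℕ}
  (cardA : ∀ i → Card (λ t → size t ≡ i × A t) (α i))
  (cardB : ∀ i → Card (λ t → size t ≡ i × B t) (β i)) where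

  private
    term : ℕ → ℕ → ℕ
    term n i = α i * β (n ∸ i)

    Nodes : (ℕ → Set) → ℕ → Tree → Set
    Nodes I n x = ∃₂ λ s t → x ≡ node s t × I (size s) × size s + size t ≡ n × A s × B t

    single : ∀ n i → i ≤ n → Card (Nodes (_≡ i) n) (term n i)
    single n i i≤n = card-resp
      (λ x → mk⇔
        (λ { (s , t , e , (refl , a) , (q , b)) →
             s , t , e , refl , trans (cong (λ m → size s + m) q) (ℕP.m+[n∸m]≡n i≤n) , a , b })
        (λ { (s , t , e , refl , refl , a , b) →
             s , t , e , (refl , a) , (sym (ℕP.m+n∸m≡n (size s) (size t)) , b) }))
      (card-product node node-injective (cardA i) (cardB (n ∸ i)))

    -- The bound `m` on the left subtree grows by one per step, each step adding the pairs whose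
    -- left size is exactly `m`. The counts are therefore the partial sums of the convolution.
    upToSize : ∀ n m → m ≤ n → Card (Nodes (_≤ m) n) (sumToℕ m (term n))
    upToSize n zero    m≤n = card-resp
      (λ x → mk⇔ (λ (s , t , e , p , r) → s , t , e , ℕP.≤-reflexive p , r)
                 (λ (s , t , e , p , r) → s , t , e , ℕP.n≤0⇒n≡0 p , r))
      (single n 0 m≤n)
    upToSize n (suc m) m<n = card-resp
      (λ x → mk⇔
        (λ { (inj₁ (s , t , e , p , r)) → s , t , e , ℕP.m≤n⇒m≤1+n p , r
           ; (inj₂ (s , t , e , p , r)) → s , t , e , ℕP.≤-reflexive p , r })
        (λ (s , t , e , p , r) → split s t e r (ℕP.m≤n⇒m<n∨m≡n p)))
      (card-⊎ (λ { x (s , t , refl , p , _) (_ , _ , refl , q , _) →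
                   ℕP.<-irrefl q (s≤s p) })
        (upToSize n m (ℕP.<⇒≤ m<n)) (single n (suc m) m<n))
      where
      split : ∀ {x} s t → x ≡ node s t → size s + size t ≡ n × A s × B t →
        size s < suc m ⊎ size s ≡ suc m → Nodes (_≤ m) n x ⊎ Nodes (_≡ suc m) n x
      split s t e r (inj₁ (s≤s p)) = inj₁ (s , t , e , p , r)
      split s t e r (inj₂ p)       = inj₂ (s , t , e , p , r)

  card-node : ∀ n → Card (λ x → ∃₂ λ s t → x ≡ node s t × size x ≡ suc n × A s × B t)
                         (sumToℕ n (term n))
  card-node n = card-resp
    (λ x → mk⇔
      (λ { (s , t , refl , _ , r , ab) → s , t , refl , cong suc r , ab })
      (λ { (s , t , refl , r , ab) →
           s , t , refl , ℕP.m+n≤o⇒m≤o (size s) (ℕP.≤-reflexive (ℕP.suc-injective r)) , ℕP.suc-injective r , ab }))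
    (upToSize n n ℕP.≤-refl)

  sum-term : ∀ n → + sumToℕ n (term n) ≡ (ofℕ α ⊛ ofℕ β) n
  sum-term n = trans (sumToℕ-sumTo n (term n))
    (sumTo-cong n λ i _ → ℤP.pos-* (α i) (β (n ∸ i)))

size≢0 : ∀ t → size t ≢ 0
size≢0 leaf ()
size≢0 (node _ _) ()

count-singleton : {A : Tree → Set} {α : ℕ → ℕ} → (∀ i → Card (λ t → size t ≡ i × A t) (α i)) →
  (a : Tree) → (∀ t → A t ⇔ t ≡ a) → ofℕ α ≈ mono (+ 1) (size a)
count-singleton cardA a A⇔a n with n ≟ size a
... | yes refl = cong +_ (card-unique (λ _ → mk⇔ (λ h → h) (λ h → h)) (cardA n)
      (card-singleton a λ t → mk⇔ (to (A⇔a t) ∘ proj₂) λ { refl → refl , from (A⇔a a) refl }))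
... | no n≢a = cong +_ (card-unique (λ _ → mk⇔ (λ h → h) (λ h → h)) (cardA n)
      (card-empty λ t (p , h) → n≢a (trans (sym p) (cong size (to (A⇔a t) h)))))

-- The occurrence statistic on trees and the recurrences it satisfies.

module _ (g : Tree → ℕ) where

  -- Abstract form of the number of occurrences of τ-3-⋯-(2+e), with `g` standing for the number of
  -- occurrences of τ. In the word A n B of `node s t` the three summands count the occurrences
  -- inside A, those that end at n, and those inside B.
  occ : ℕ → Tree → ℕ
  occ zero    t          = g t
  occ (suc e) leaf       = 0
  occ (suc e) (node s t) = occ (suc e) s + occ e s + occ (suc e) t

  avoidanceSeries onceSeries : ℕ → Series
  avoidanceSeries e = ofℕ (countOfSize (λ t → occ e t ≡ 0) (λ t → occ e t ≟ 0))
  onceSeries e = ofℕ (countOfSize (λ t → occ e t ≡ 1) (λ t → occ e t ≟ 1))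

  never-one : (∀ t → g t ≢ 1) → ∀ e t → occ e t ≢ 1
  never-one h zero    t = h t
  never-one h (suc e) leaf ()
  never-one h (suc e) (node s t) =
    sum₃≢1 _ (occ e s) _ (never-one h (suc e) s) (never-one h e s) (never-one h (suc e) t)
    where
    sum₃≢1 : ∀ a b c → a ≢ 1 → b ≢ 1 → c ≢ 1 → a + b + c ≢ 1
    sum₃≢1 zero          zero          c p q r e = r e
    sum₃≢1 zero          (suc zero)    c p q r e = q refl
    sum₃≢1 (suc zero)    b             c p q r e = p refl

  -- These three facts are all that distinguishes 12, 21 and 1-2 from 2-1, which violates
  -- `g-cherry`.
  module _ (g-leaf : g leaf ≡ 0) (g-cherry : g (node leaf leaf) ≡ 1)
    (g-node : ∀ s t → s ≢ leaf ⊎ t ≢ leaf → 2 ≤ g (node s t)) where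

    -- At the base, a positive `occ 1` excludes the leaf and the cherry, and `g-node` covers the
    -- rest. Above it, some summand of `occ (2 + e)` is positive; the induction hypothesis for that
    -- summand, one level down, gives at least 2 in the matching summand of `occ (1 + e)`.
    occ-mono : ∀ e t → 1 ≤ occ (suc e) t → 2 ≤ occ e t
    occ-mono zero (node s@(node _ _) t) _ = g-node s t (inj₁ λ ())
    occ-mono zero (node leaf t@(node _ _)) _ = g-node leaf t (inj₂ λ ())
    occ-mono zero (node leaf leaf) 1≤ rewrite g-leaf = contradiction 1≤ λ ()
    occ-mono (suc e) (node s t) 1≤ with occ (2 + e) s in p | occ (1 + e) s in q
    ... | suc _ | _ = ℕP.m≤n⇒m≤n+o _ (ℕP.m≤n⇒m≤n+o _
          (subst (2 ≤_) q (occ-mono (suc e) s (subst (1 ≤_) (sym p) (s≤s z≤n)))))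
    ... | zero | b@(suc _) = ℕP.m≤n⇒m≤n+o _ (ℕP.m≤n⇒m≤o+n b
          (occ-mono e s (subst (1 ≤_) (sym q) (s≤s z≤n))))
    ... | zero | zero = ℕP.m≤n⇒m≤o+n (occ e s) (occ-mono (suc e) t 1≤)

    occ≤1⇒0 : ∀ e t → occ e t ≤ 1 → occ (suc e) t ≡ 0
    occ≤1⇒0 e t h with occ (suc e) t in p
    ... | zero  = refl
    ... | suc _ = contradiction (occ-mono e t (subst (1 ≤_) (sym p) (s≤s z≤n))) (ℕP.<⇒≱ (s≤s h))

    Z O : ℕ → Tree → Set
    Z e t = occ e t ≡ 0
    O e t = occ e t ≡ 1

    private
      cardZ : ∀ e n → Card (λ t → size t ≡ n × Z e t) _
      cardZ e = countOfSize-card (Z e) (λ t → occ e t ≟ 0)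
      cardO : ∀ e n → Card (λ t → size t ≡ n × O e t) _
      cardO e = countOfSize-card (O e) (λ t → occ e t ≟ 1)

    -- The condition that A itself has no longer occurrence is absent on the right because
    -- `occ e s ≡ 0` already implies it. This leaves a product of one condition on each subtree,
    -- hence a convolution.
    node-Z : ∀ e s t → Z (suc e) (node s t) ⇔ (Z e s × Z (suc e) t)
    node-Z e s t = mk⇔
      (λ h → ℕP.m+n≡0⇒n≡0 (occ (suc e) s) (ℕP.m+n≡0⇒m≡0 _ h) , ℕP.m+n≡0⇒n≡0 (occ (suc e) s + occ e s) h)
      (λ (p , q) → cong₂ _+_ (cong₂ _+_ (occ≤1⇒0 e s (ℕP.≤-trans (ℕP.≤-reflexive p) z≤n)) p) q)

    -- The one occurrence cannot lie inside A: by `occ-mono`, A would then have two shorter ones,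
    -- and each of them extends by n. So the first summand is 0 and the remaining two add up to 1.
    node-O : ∀ e s t → O (suc e) (node s t) ⇔ ((O e s × Z (suc e) t) ⊎ (Z e s × O (suc e) t))
    node-O e s t = mk⇔ split join
      where
      split : O (suc e) (node s t) → (O e s × Z (suc e) t) ⊎ (Z e s × O (suc e) t)
      split h with occ (suc e) s in p | occ e s in q
      ... | zero | zero = inj₂ (refl , h)
      ... | zero | suc zero = inj₁ (refl , ℕP.suc-injective h)
      ... | suc _ | b with subst (2 ≤_) q (occ-mono e s (subst (1 ≤_) (sym p) (s≤s z≤n)))
      split h | suc a | suc (suc b) | s≤s (s≤s _) =
        contradiction (ℕP.suc-injective h) λ h′ →
          contradiction (ℕP.m+n≡0⇒n≡0 a (ℕP.m+n≡0⇒m≡0 (a + suc (suc b)) h′)) λ ()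
      join : (O e s × Z (suc e) t) ⊎ (Z e s × O (suc e) t) → O (suc e) (node s t)
      join (inj₁ (p , q)) = cong₂ _+_ (cong₂ _+_ (occ≤1⇒0 e s (ℕP.≤-reflexive p)) p) q
      join (inj₂ (p , q)) = cong₂ _+_ (cong₂ _+_ (occ≤1⇒0 e s (ℕP.≤-trans (ℕP.≤-reflexive p) z≤n)) p) q

    O-leaf : ∀ e → ¬ O e leaf
    O-leaf zero    h = contradiction (trans (sym g-leaf) h) λ ()
    O-leaf (suc e) ()

    Z₀ : ∀ t → Z 0 t ⇔ t ≡ leaf
    Z₀ leaf = mk⇔ (λ _ → refl) (λ _ → g-leaf)
    Z₀ (node s t) = mk⇔ (λ h → contradiction h (ℕP.>⇒≢ (positive s t))) λ ()
      where
      positive : ∀ s t → 1 ≤ g (node s t)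
      positive leaf leaf = ℕP.≤-reflexive (sym g-cherry)
      positive leaf t@(node _ _) = ℕP.<⇒≤ (g-node leaf t (inj₂ λ ()))
      positive s@(node _ _) t = ℕP.<⇒≤ (g-node s t (inj₁ λ ()))

    O₀ : ∀ t → O 0 t ⇔ t ≡ node leaf leaf
    O₀ leaf = mk⇔ (⊥-elim ∘ O-leaf 0) λ ()
    O₀ (node leaf leaf) = mk⇔ (λ _ → refl) (λ _ → g-cherry)
    O₀ (node leaf t@(node _ _)) =
      mk⇔ (λ h → contradiction h (ℕP.>⇒≢ (g-node leaf t (inj₂ λ ())))) λ ()
    O₀ (node s@(node _ _) t) =
      mk⇔ (λ h → contradiction h (ℕP.>⇒≢ (g-node s t (inj₁ λ ())))) λ ()

    avoidance-base : avoidanceSeries 0 ≈ X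
    avoidance-base = count-singleton (cardZ 0) leaf Z₀

    once-base : onceSeries 0 ≈ mono (+ 1) 3
    once-base = count-singleton (cardO 0) (node leaf leaf) O₀

    avoidance-rec : ∀ e → avoidanceSeries (suc e)
      ≈ X ⊞ X ⊛ (avoidanceSeries e ⊛ avoidanceSeries (suc e))
    avoidance-rec e zero = cong +_ (card-unique (λ x → mk⇔ proj₁ λ h → contradiction h (size≢0 x))
      (cardZ (suc e) 0) (card-empty size≢0))
    avoidance-rec e (suc n) = begin
      + _
        ≡⟨ cong +_ (card-unique shape (cardZ (suc e) (suc n))
             (card-⊎ (λ { _ (_ , refl) (_ , _ , () , _) })
               (cardLeaf (suc n)) (card-node (cardZ e) (cardZ (suc e)) n))) ⟩
      + (leaves (suc n) + _)
        ≡⟨ cong₂ ℤ._+_ (count-singleton cardLeaf leaf (λ _ → mk⇔ (λ h → h) (λ h → h)) (suc n))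
             (trans (sum-term (cardZ e) (cardZ (suc e)) n) (sym (X-⊛ conv (suc n)))) ⟩
      (X ⊞ X ⊛ conv) (suc n) ∎
      where
      open ≡-Reasoning
      conv = avoidanceSeries e ⊛ avoidanceSeries (suc e)
      leaf? : ∀ t → Dec (t ≡ leaf)
      leaf? leaf = yes refl
      leaf? (node _ _) = no λ ()
      leaves = countOfSize (_≡ leaf) leaf?
      cardLeaf = countOfSize-card (_≡ leaf) leaf?
      shape : ∀ x → (size x ≡ suc n × Z (suc e) x) ⇔ ((size x ≡ suc n × x ≡ leaf)
        ⊎ (∃₂ λ s t → x ≡ node s t × size x ≡ suc n × Z e s × Z (suc e) t))
      shape leaf = mk⇔ (λ (p , _) → inj₁ (p , refl)) (λ { (inj₁ (p , _)) → p , refl })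
      shape (node s t) = mk⇔
        (λ (p , h) → inj₂ (s , t , refl , p , to (node-Z e s t) h))
        (λ { (inj₂ (_ , _ , refl , p , h)) → p , from (node-Z e s t) h })

    once-rec : ∀ e → onceSeries (suc e)
      ≈ X ⊛ (onceSeries e ⊛ avoidanceSeries (suc e) ⊞ avoidanceSeries e ⊛ onceSeries (suc e))
    once-rec e zero = cong +_ (card-unique (λ x → mk⇔ proj₁ λ h → contradiction h (size≢0 x))
      (cardO (suc e) 0) (card-empty size≢0))
    once-rec e (suc n) = begin
      + _
        ≡⟨ trans (cong +_ (card-unique shape (cardO (suc e) (suc n))
             (card-⊎ disjoint
               (card-node (cardO e) (cardZ (suc e)) n) (card-node (cardZ e) (cardO (suc e)) n))))
             (cong₂ ℤ._+_ (sum-term (cardO e) (cardZ (suc e)) n)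
                          (sum-term (cardZ e) (cardO (suc e)) n)) ⟩
      conv n
        ≡⟨ X-⊛ conv (suc n) ⟨
      (X ⊛ conv) (suc n) ∎
      where
      open ≡-Reasoning
      conv = onceSeries e ⊛ avoidanceSeries (suc e) ⊞ avoidanceSeries e ⊛ onceSeries (suc e)
      Nodes : (Tree → Set) → (Tree → Set) → Tree → Set
      Nodes A B x = ∃₂ λ s t → x ≡ node s t × size x ≡ suc n × A s × B t
      disjoint : ∀ x → Nodes (O e) (Z (suc e)) x → ¬ Nodes (Z e) (O (suc e)) x
      disjoint x (_ , _ , refl , _ , p , _) (_ , _ , refl , _ , q , _) =
        contradiction (trans (sym p) q) λ ()
      shape : ∀ x → (size x ≡ suc n × O (suc e) x)
        ⇔ (Nodes (O e) (Z (suc e)) x ⊎ Nodes (Z e) (O (suc e)) x)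
      shape leaf = mk⇔ (λ ()) (λ { (inj₁ (_ , _ , () , _)) ; (inj₂ (_ , _ , () , _)) })
      shape (node s t) = mk⇔
        (λ (p , h) → [ (λ h → inj₁ (s , t , refl , p , h)) , (λ h → inj₂ (s , t , refl , p , h)) ]′
                       (to (node-O e s t) h))
        (λ { (inj₁ (_ , _ , refl , p , h)) → p , from (node-O e s t) (inj₁ h)
           ; (inj₂ (_ , _ , refl , p , h)) → p , from (node-O e s t) (inj₂ h) })

    onceSeries-closed : ∀ e → (onceSeries e ⊛ chebW (suc e)) ⊛ chebW (suc e)
      ≈ mono (+ (2 ℕ.^ (2 * suc e))) (suc (2 * suc e))
    onceSeries-closed = ps-closed avoidanceSeries onceSeries
      avoidance-base once-base avoidance-rec once-rec

-- Letters by index, and the skew join of two words.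

!!-++ˡ : ∀ xs {ys i} → i < length xs → (xs ++ ys) !! i ≡ xs !! i
!!-++ˡ (x ∷ xs) {i = zero}  _         = refl
!!-++ˡ (x ∷ xs) {i = suc i} (s≤s i<n) = !!-++ˡ xs i<n

!!-++ʳ : ∀ xs {ys} i → (xs ++ ys) !! (length xs + i) ≡ ys !! i
!!-++ʳ []       i = refl
!!-++ʳ (x ∷ xs) i = !!-++ʳ xs i

!!-∷ʳ : ∀ xs {x} → (xs ∷ʳ x) !! length xs ≡ x
!!-∷ʳ []       = refl
!!-∷ʳ (_ ∷ xs) = !!-∷ʳ xs

!!-map : ∀ f xs {i} → i < length xs → map f xs !! i ≡ f (xs !! i)
!!-map f (x ∷ xs) {zero}  _         = refl
!!-map f (x ∷ xs) {suc i} (s≤s i<n) = !!-map f xs i<n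

!!-applyUpTo : ∀ f {n i} → i < n → applyUpTo f n !! i ≡ f i
!!-applyUpTo f {suc n} {zero}  _         = refl
!!-applyUpTo f {suc n} {suc i} (s≤s i<n) = !!-applyUpTo (f ∘ suc) i<n

!!-∈ : ∀ xs {i} → i < length xs → xs !! i ∈ xs
!!-∈ (x ∷ xs) {zero}  _         = here refl
!!-∈ (x ∷ xs) {suc i} (s≤s i<n) = there (!!-∈ xs i<n)

∈-!! : ∀ {xs x} → x ∈ xs → ∃ λ i → i < length xs × xs !! i ≡ x
∈-!! (here refl) = 0 , s≤s z≤n , refl
∈-!! (there x∈)  = let i , i<n , e = ∈-!! x∈ in suc i , s≤s i<n , e

All-!!⁺ : ∀ {P : ℕ → Set} xs → (∀ i → i < length xs → P (xs !! i)) → All P xs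
All-!!⁺ []       h = []
All-!!⁺ (x ∷ xs) h = h 0 (s≤s z≤n) ∷ All-!!⁺ xs λ i i<n → h (suc i) (s≤s i<n)

All-!!⁻ : ∀ {P : ℕ → Set} {xs} → All P xs → ∀ i → i < length xs → P (xs !! i)
All-!!⁻ (p ∷ ps) zero    _         = p
All-!!⁻ (p ∷ ps) (suc i) (s≤s i<n) = All-!!⁻ ps i i<n

length-∷ʳ : ∀ (xs : List ℕ) x → length (xs ∷ʳ x) ≡ suc (length xs)
length-∷ʳ xs x = trans (length-++ xs) (ℕP.+-comm (length xs) 1)

-- The skew decomposition A n B of a 132-avoiding permutation around its maximum.
join : List ℕ → List ℕ → List ℕ
join A B = map (_+ length B) A ++ suc (length A + length B) ∷ B

length-join : ∀ A B → length (join A B) ≡ suc (length A + length B)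
length-join A B = begin
  length (join A B)                               ≡⟨ length-++ (map (_+ length B) A) ⟩
  length (map (_+ length B) A) + suc (length B)   ≡⟨ cong (_+ suc (length B)) (length-map _ A) ⟩
  length A + suc (length B)                       ≡⟨ ℕP.+-suc (length A) (length B) ⟩
  suc (length A + length B)                       ∎
  where open ≡-Reasoning

join-left : ∀ A B {i} → i < length A → join A B !! i ≡ A !! i + length B
join-left A B i<a = trans
  (!!-++ˡ (map (_+ length B) A) (subst (_ <_) (sym (length-map _ A)) i<a)) (!!-map _ A i<a)

join-mid : ∀ A B → join A B !! length A ≡ suc (length A + length B)
join-mid A B = trans
  (cong (join A B !!_) (sym (trans (ℕP.+-identityʳ _) (length-map _ A))))
  (!!-++ʳ (map (_+ length B) A) 0)

join-right : ∀ A B j → join A B !! suc (length A + j) ≡ B !! j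
join-right A B j = trans
  (cong (join A B !!_) (sym (trans (cong (_+ suc j) (length-map _ A)) (ℕP.+-suc (length A) j))))
  (!!-++ʳ (map (_+ length B) A) (suc j))

data Position (a : ℕ) : ℕ → Set where
  left  : ∀ {i} → i < a → Position a i
  mid   : Position a a
  right : ∀ j → Position a (suc (a + j))

position : ∀ a i → Position a i
position zero    zero    = mid
position zero    (suc i) = right i
position (suc a) zero    = left (s≤s z≤n)
position (suc a) (suc i) with position a i
... | left i<a = left (s≤s i<a)
... | mid      = mid
... | right j  = right j

-- The part of being a permutation that decides every comparison between different blocks of
-- `join A B`. It is proved by plain recursion on trees, before anything is known about
-- permutations.
Bounded : List ℕ → Set
Bounded π = ∀ i → i < length π → 1 ≤ π !! i × π !! i ≤ length π

module Join (A B : List ℕ) (bA : Bounded A) (bB : Bounded B) where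

  private
    a = length A
    b = length B
    w = join A B

  left-length : ∀ {i} → i < a → i < length w
  left-length i<a = subst (_ <_) (sym (length-join A B)) (ℕP.m≤n⇒m≤1+n (ℕP.m≤n⇒m≤n+o b i<a))

  mid-length : a < length w
  mid-length = subst (a <_) (sym (length-join A B)) (s≤s (ℕP.m≤m+n a b))

  right-length : ∀ {j} → j < b → suc (a + j) < length w
  right-length j<b = subst (_ <_) (sym (length-join A B)) (s≤s (ℕP.+-monoʳ-< a j<b))

  right-length⁻ : ∀ {j} → suc (a + j) < length w → j < b
  right-length⁻ {j} h = ℕP.+-cancelˡ-< a j b (ℕP.≤-pred (subst (_ <_) (length-join A B) h))

  left-<⁺ : ∀ {i j} → i < a → j < a → A !! i < A !! j → w !! i < w !! j
  left-<⁺ i<a j<a h = subst₂ _<_ (sym (join-left A B i<a)) (sym (join-left A B j<a)) (ℕP.+-monoˡ-< b h)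

  left-<⁻ : ∀ {i j} → i < a → j < a → w !! i < w !! j → A !! i < A !! j
  left-<⁻ {i} {j} i<a j<a h = ℕP.+-cancelʳ-< b (A !! i) (A !! j)
    (subst₂ _<_ (join-left A B i<a) (join-left A B j<a) h)

  right-<⁺ : ∀ {i j} → B !! i < B !! j → w !! suc (a + i) < w !! suc (a + j)
  right-<⁺ {i} {j} h = subst₂ _<_ (sym (join-right A B i)) (sym (join-right A B j)) h

  right-<⁻ : ∀ {i j} → w !! suc (a + i) < w !! suc (a + j) → B !! i < B !! j
  right-<⁻ {i} {j} h = subst₂ _<_ (join-right A B i) (join-right A B j) h

  left<mid : ∀ {i} → i < a → w !! i < w !! a
  left<mid {i} i<a = subst₂ _<_ (sym (join-left A B i<a)) (sym (join-mid A B))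
    (s≤s (ℕP.+-monoˡ-≤ b (proj₂ (bA i i<a))))

  right<mid : ∀ {j} → j < b → w !! suc (a + j) < w !! a
  right<mid {j} j<b = subst₂ _<_ (sym (join-right A B j)) (sym (join-mid A B))
    (s≤s (ℕP.≤-trans (proj₂ (bB j j<b)) (ℕP.m≤n+m b a)))

  right<left : ∀ {i j} → i < a → j < b → w !! suc (a + j) < w !! i
  right<left {i} {j} i<a j<b = subst₂ _<_ (sym (join-right A B j)) (sym (join-left A B i<a))
    (ℕP.≤-<-trans (proj₂ (bB j j<b)) (ℕP.+-monoˡ-≤ b (proj₁ (bA i i<a))))

  ≤mid : ∀ {i} → i < length w → w !! i ≤ w !! a
  ≤mid {i} i<w with position a i
  ... | left i<a = ℕP.<⇒≤ (left<mid i<a)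
  ... | mid      = ℕP.≤-refl
  ... | right j  = ℕP.<⇒≤ (right<mid (right-length⁻ i<w))

  bounded : Bounded w
  bounded i i<w with position a i
  ... | left i<a = subst (1 ≤_) (sym (join-left A B i<a)) (ℕP.m≤n⇒m≤n+o b (proj₁ (bA i i<a))) , ≤w
    where
    ≤w : w !! i ≤ length w
    ≤w = subst (w !! i ≤_) (trans (join-mid A B) (sym (length-join A B))) (≤mid i<w)
  ... | mid = subst (1 ≤_) (sym (join-mid A B)) (s≤s z≤n) ,
              ℕP.≤-reflexive (trans (join-mid A B) (sym (length-join A B)))
  ... | right j = subst (1 ≤_) (sym (join-right A B j)) (proj₁ (bB j (right-length⁻ i<w))) ,
              subst (w !! i ≤_) (trans (join-mid A B) (sym (length-join A B))) (≤mid i<w)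

lastLeaf : Bool → List ℕ
lastLeaf true  = 1 ∷ []
lastLeaf false = []

-- The rightmost leaf is read as the letter 1 or dropped, according to the parity of the length.
word : Bool → Tree → List ℕ
word b leaf       = lastLeaf b
word b (node s t) = join (word true s) (word b t)

word-bounded : ∀ b t → Bounded (word b t)
word-bounded true  leaf zero    _        = s≤s z≤n , s≤s z≤n
word-bounded true  leaf (suc _) (s≤s ())
word-bounded false leaf _       ()
word-bounded b (node s t) =
  Join.bounded (word true s) (word b t) (word-bounded true s) (word-bounded b t)

length-word : ∀ t → length (word true t) ≡ size t
length-word leaf       = refl
length-word (node s t) = trans (length-join (word true s) (word true t))
  (cong suc (cong₂ _+_ (length-word s) (length-word t)))

length-word-false : ∀ t → suc (length (word false t)) ≡ size t
length-word-false leaf       = refl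
length-word-false (node s t) = cong suc (trans (length-join (word true s) (word false t))
  (trans (cong (λ m → suc (m + length (word false t))) (length-word s))
  (trans (sym (ℕP.+-suc (size s) _)) (cong (λ m → size s + m) (length-word-false t)))))

Order : Bool → ℕ → ℕ → Set
Order true  x y = x < y
Order false x y = y < x

order? : ∀ asc x y → Dec (Order asc x y)
order? true  x y = x <? y
order? false x y = y <? x

-- Occurrences of the four patterns: `asc` chooses 1, 2 or 2, 1 as first letters, and `adjacent`
-- forbids the first dash.

module Patterns (asc adjacent : Bool) where

  firstTwo : Bool → List ℕ → List ℕ
  firstTwo true  l = 1 ∷ 2 ∷ l
  firstTwo false l = 2 ∷ 1 ∷ l

  -- τ-3-⋯-k with k = 2 + e
  tauTo : ℕ → Pattern
  tauTo e = mkPattern (firstTwo asc (from3to (2 + e))) (adjacent ∷ replicate e false)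

  -- Occurrences of τ-3-⋯-(2+e), built by appending the letters 3, 4, … one at a time.
  data Occ (π : List ℕ) : ℕ → List ℕ → Set where
    pair : ∀ {i j} → i < j → j < length π → (adjacent ≡ true → j ≡ suc i) →
      Order asc (π !! i) (π !! j) → Occ π 0 (i ∷ j ∷ [])
    extend : ∀ {e is js m} → Occ π e is → All (λ i → i < m × π !! i < π !! m) is →
      m < length π → js ≡ is ∷ʳ m → Occ π (suc e) js

  letter : Bool → ℕ → ℕ
  letter _     (suc (suc a)) = 3 + a
  letter true  zero          = 1
  letter true  (suc zero)    = 2
  letter false zero          = 2
  letter false (suc zero)    = 1

  letters-!! : ∀ e a → a < 2 + e → letters (tauTo e) !! a ≡ letter asc a
  letters-!! e = go asc
    where
    rest : ∀ a → a < e → from3to (2 + e) !! a ≡ 3 + a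
    rest a a<e = trans (!!-map (λ m → 3 + m) (upTo e) (subst (a <_) (sym (length-upTo e)) a<e))
      (cong (λ m → 3 + m) (!!-applyUpTo id a<e))
    go : ∀ c a → a < 2 + e → firstTwo c (from3to (2 + e)) !! a ≡ letter c a
    go true  zero          _               = refl
    go true  (suc zero)    _               = refl
    go true  (suc (suc a)) (s≤s (s≤s a<e)) = rest a a<e
    go false zero          _               = refl
    go false (suc zero)    _               = refl
    go false (suc (suc a)) (s≤s (s≤s a<e)) = rest a a<e

  length-letters : ∀ e → length (letters (tauTo e)) ≡ 2 + e
  length-letters e = go asc
    where
    go : ∀ c → length (firstTwo c (from3to (2 + e))) ≡ 2 + e
    go true  = cong (λ m → 2 + m) (trans (length-map _ (upTo e)) (length-upTo e))
    go false = cong (λ m → 2 + m) (trans (length-map _ (upTo e)) (length-upTo e))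

  letter-last : ∀ e a → a < 2 + e → letter asc a < 3 + e
  letter-last e = go asc
    where
    go : ∀ c a → a < 2 + e → letter c a < 3 + e
    go true  zero          _   = s≤s (s≤s z≤n)
    go true  (suc zero)    _   = s≤s (s≤s (s≤s z≤n))
    go true  (suc (suc a)) a<e = s≤s a<e
    go false zero          _   = s≤s (s≤s (s≤s z≤n))
    go false (suc zero)    _   = s≤s (s≤s z≤n)
    go false (suc (suc a)) a<e = s≤s a<e

  -- `Occurrence` with the letters given by a function instead of a list, all bounds written as
  -- `2 + e`, and adjacency asked only of the first gap, since every other flag is `false`.
  Spec : ℕ → List ℕ → List ℕ → Set
  Spec e π is =
    (length is ≡ 2 + e) ×
    (∀ a → a < 2 + e → is !! a < length π) ×
    (∀ a → suc a < 2 + e → is !! a < is !! suc a) ×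
    (∀ a b → a < 2 + e → b < 2 + e →
       (letter asc a < letter asc b) ⇔ (π !! (is !! a) < π !! (is !! b))) ×
    (adjacent ≡ true → is !! 1 ≡ suc (is !! 0))

  bool!!-replicate : ∀ e a → bool!! (replicate e false) a ≡ false
  bool!!-replicate zero    a       = refl
  bool!!-replicate (suc e) zero    = refl
  bool!!-replicate (suc e) (suc a) = bool!!-replicate e a

  occurrence⇔spec : ∀ e π is → Occurrence (tauTo e) π is ⇔ Spec e π is
  occurrence⇔spec e π is = mk⇔ forth back
    where
    ⇔-letters : ∀ {Y : Set} a b → a < 2 + e → b < 2 + e →
      ((letters (tauTo e) !! a < letters (tauTo e) !! b) ⇔ Y) ≡ ((letter asc a < letter asc b) ⇔ Y)
    ⇔-letters {Y} a b a< b< = cong₂ (λ x y → (x < y) ⇔ Y) (letters-!! e a a<) (letters-!! e b b<)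
    forth : Occurrence (tauTo e) π is → Spec e π is
    forth (l , bound , inc , ord , adj) = l′ ,
      (λ a a< → bound a (in′ a<)) ,
      (λ a a< → inc a (in′ a<)) ,
      (λ a b a< b< → subst id (⇔-letters a b a< b<) (ord a b (in′ a<) (in′ b<))) ,
      adj 0 (in′ (s≤s (s≤s z≤n)))
      where
      l′ = trans l (length-letters e)
      in′ : ∀ {a} → a < 2 + e → a < length is
      in′ = subst (_ <_) (sym l′)
    back : Spec e π is → Occurrence (tauTo e) π is
    back (l , bound , inc , ord , adj) = trans l (sym (length-letters e)) ,
      (λ a a< → bound a (in′ a<)) ,
      (λ a a< → inc a (in′ a<)) ,
      (λ a b a< b< → subst id (sym (⇔-letters a b (in′ a<) (in′ b<))) (ord a b (in′ a<) (in′ b<))) ,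
      (λ { zero _ h → adj h
         ; (suc a) _ h → contradiction (trans (sym h) (bool!!-replicate e a)) λ () })
      where
      in′ : ∀ {a} → a < length is → a < 2 + e
      in′ = subst (_ <_) l

  chain-< : ∀ (f : ℕ → ℕ) {n} → (∀ a → suc a < n → f a < f (suc a)) →
    ∀ i j → i < j → j < n → f i < f j
  chain-< f inc i (suc j) (s≤s i≤j) j<n with ℕP.m≤n⇒m<n∨m≡n i≤j
  ... | inj₁ i<j  = ℕP.<-trans (chain-< f inc i j i<j (ℕP.<-trans (ℕP.n<1+n j) j<n)) (inc j j<n)
  ... | inj₂ refl = inc j j<n

  -- The last index is peeled off. Its pattern letter `3 + e` is the largest, so order-isomorphism
  -- places the letter there above all earlier ones; the remaining indices satisfy the same
  -- specification one level down.
  spec⇒occ : ∀ e π is → Spec e π is → Occ π e is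
  spec⇒occ zero π (i ∷ j ∷ []) (_ , bound , inc , ord , adj) =
    pair (inc 0 (s≤s (s≤s z≤n))) (bound 1 (s≤s (s≤s z≤n))) adj
      (order asc (ord 0 1 (s≤s z≤n) (s≤s (s≤s z≤n))) (ord 1 0 (s≤s (s≤s z≤n)) (s≤s z≤n)))
    where
    order : ∀ c {x y} → (letter c 0 < letter c 1) ⇔ (x < y) →
      (letter c 1 < letter c 0) ⇔ (y < x) → Order c x y
    order true  p q = to p (s≤s (s≤s z≤n))
    order false p q = to q (s≤s (s≤s z≤n))
  spec⇒occ (suc e) π js sp with initLast js
  spec⇒occ (suc e) π .[] (() , _) | []
  spec⇒occ (suc e) π .(is ∷ʳ m) (l , bound , inc , ord , adj) | is ∷ʳ′ m =
    extend
      (spec⇒occ e π is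
        ( len
        , (λ a a< → subst (_< length π) (look a<) (bound a (ℕP.m≤n⇒m≤1+n a<)))
        , (λ a a< → subst₂ _<_ (look (ℕP.<-trans (ℕP.n<1+n a) a<)) (look a<) (inc a (ℕP.m≤n⇒m≤1+n a<)))
        , (λ a b a< b< → subst₂ (λ x y → (letter asc a < letter asc b) ⇔ (π !! x < π !! y))
             (look a<) (look b<) (ord a b (ℕP.m≤n⇒m≤1+n a<) (ℕP.m≤n⇒m≤1+n b<)))
        , (λ h → subst₂ (λ x y → y ≡ suc x) (look (s≤s z≤n)) (look (s≤s (s≤s z≤n))) (adj h)) ))
      (All-!!⁺ is λ i i< → let i<′ = subst (i <_) len i< in
        subst₂ _<_ (look i<′) last (chain-< ((is ∷ʳ m) !!_) inc i (2 + e) i<′ ℕP.≤-refl) ,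
        subst₂ (λ x y → π !! x < π !! y) (look i<′) last
          (to (ord i (2 + e) (ℕP.m≤n⇒m≤1+n i<′) ℕP.≤-refl) (letter-last e i i<′)))
      (subst (_< length π) last (bound (2 + e) ℕP.≤-refl))
      refl
    where
    len : length is ≡ 2 + e
    len = ℕP.suc-injective (trans (sym (length-∷ʳ is m)) l)
    look : ∀ {a} → a < 2 + e → (is ∷ʳ m) !! a ≡ is !! a
    look a< = !!-++ˡ is (subst (_ <_) (sym len) a<)
    last : (is ∷ʳ m) !! (2 + e) ≡ m
    last = subst (λ n → (is ∷ʳ m) !! n ≡ m) len (!!-∷ʳ is)

  both-false : {P Q : Set} → ¬ P → ¬ Q → P ⇔ Q
  both-false ¬p ¬q = mk⇔ (⊥-elim ∘ ¬p) (⊥-elim ∘ ¬q)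

  both-true : {P Q : Set} → P → Q → P ⇔ Q
  both-true p q = mk⇔ (λ _ → q) (λ _ → p)

  occ⇒spec : ∀ e π is → Occ π e is → Spec e π is
  occ⇒spec zero π _ (pair {i} {j} i<j j<n adj o) =
    refl ,
    (λ { zero _ → ℕP.<-trans i<j j<n ; (suc zero) _ → j<n ; (suc (suc _)) (s≤s (s≤s ())) }) ,
    (λ { zero _ → i<j ; (suc _) (s≤s (s≤s ())) }) ,
    order asc o ,
    adj
    where
    order : ∀ c → Order c (π !! i) (π !! j) → ∀ a b → a < 2 → b < 2 →
      (letter c a < letter c b) ⇔ (π !! ((i ∷ j ∷ []) !! a) < π !! ((i ∷ j ∷ []) !! b))
    order c     o zero       zero       _ _ = both-false (ℕP.<-irrefl refl) (ℕP.<-irrefl refl)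
    order c     o (suc zero) (suc zero) _ _ = both-false (ℕP.<-irrefl refl) (ℕP.<-irrefl refl)
    order true  o zero       (suc zero) _ _ = both-true (s≤s (s≤s z≤n)) o
    order true  o (suc zero) zero       _ _ = both-false (λ { (s≤s ()) }) (ℕP.<-asym o)
    order false o zero       (suc zero) _ _ = both-false (λ { (s≤s ()) }) (ℕP.<-asym o)
    order false o (suc zero) zero       _ _ = both-true (s≤s (s≤s z≤n)) o
    order c     o (suc (suc _)) _ (s≤s (s≤s ())) _
    order c     o _ (suc (suc _)) _ (s≤s (s≤s ()))
  occ⇒spec (suc e) π _ (extend {is = is} {m = m} o below m<n refl)
    with occ⇒spec e π is o
  ... | len , bound , inc , ord , adj =
    trans (length-∷ʳ is m) (cong suc len) ,
    (λ a a< → case′ a< (λ a<′ → subst (_< length π) (sym (look a<′)) (bound a a<′))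
                       (λ { refl → subst (_< length π) (sym last) m<n })) ,
    (λ a a< → case′ a<
      (λ a<′ → subst₂ _<_ (sym (look (ℕP.<-trans (ℕP.n<1+n a) a<′))) (sym (look a<′)) (inc a a<′))
      (λ { refl → subst₂ _<_ (sym (look ℕP.≤-refl)) (sym last)
                    (proj₁ (All-!!⁻ below (suc e) (subst (_ <_) (sym len) ℕP.≤-refl))) })) ,
    (λ a b a< b< → case′ a<
      (λ a<′ → case′ b<
        (λ b<′ → subst₂ (λ x y → (letter asc a < letter asc b) ⇔ (π !! x < π !! y))
                   (sym (look a<′)) (sym (look b<′)) (ord a b a<′ b<′))
        (λ { refl → both-true (letter-last e a a<′) (old<new a<′) }))
      (λ { refl → case′ b<
        (λ b<′ → both-false (ℕP.<-asym (letter-last e b b<′)) (ℕP.<-asym (old<new b<′)))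
        (λ { refl → both-false (ℕP.<-irrefl refl) (ℕP.<-irrefl refl) }) })) ,
    (λ h → trans (look (s≤s (s≤s z≤n))) (trans (adj h) (cong suc (sym (look (s≤s z≤n))))))
    where
    case′ : ∀ {C : Set} {a} → a < 3 + e → (a < 2 + e → C) → (a ≡ 2 + e → C) → C
    case′ (s≤s a≤) f g = [ f , g ]′ (ℕP.m≤n⇒m<n∨m≡n a≤)
    look : ∀ {a} → a < 2 + e → (is ∷ʳ m) !! a ≡ is !! a
    look a< = !!-++ˡ is (subst (_ <_) (sym len) a<)
    last : (is ∷ʳ m) !! (2 + e) ≡ m
    last = subst (λ n → (is ∷ʳ m) !! n ≡ m) len (!!-∷ʳ is)
    old<new : ∀ {a} → a < 2 + e → π !! ((is ∷ʳ m) !! a) < π !! ((is ∷ʳ m) !! (2 + e))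
    old<new {a} a< = subst₂ (λ x y → π !! x < π !! y) (sym (look a<)) (sym last)
      (proj₂ (All-!!⁻ below a (subst (_ <_) (sym len) a<)))

  occurrence⇔occ : ∀ e π is → Occurrence (tauTo e) π is ⇔ Occ π e is
  occurrence⇔occ e π is =
    ⇔-trans (occurrence⇔spec e π is) (mk⇔ (spec⇒occ e π is) (occ⇒spec e π is))

  occ-length : ∀ {π e is} → Occ π e is → All (_< length π) is
  occ-length (pair i<j j<n _ _)         = ℕP.<-trans i<j j<n ∷ j<n ∷ []
  occ-length (extend o below m<n refl) = All.++⁺ (occ-length o) (m<n ∷ [])

  occ-nonempty : ∀ {π e} → ¬ Occ π e []
  occ-nonempty (extend {is = []} o _ _ _) = occ-nonempty o

  -- Indices outside `P` are left unconstrained, which allows partial maps such as the passage from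
  -- A n B to B. Comparisons of letters are preserved in one direction only, because `Occ` stores
  -- only inequalities that hold.
  record Embedding (P : ℕ → Set) (π π′ : List ℕ) (f : ℕ → ℕ) : Set where
    field
      in-range : ∀ {i} → P i → f i < length π′
      mono-<   : ∀ {i j} → P i → P j → i < j → f i < f j
      mono-suc : ∀ {i} → P i → P (suc i) → f (suc i) ≡ suc (f i)
      mono-!!  : ∀ {i j} → P i → P j → π !! i < π !! j → π′ !! f i < π′ !! f j

  transport : ∀ {P π π′ f e is} → Embedding P π π′ f → Occ π e is → All P is → Occ π′ e (map f is)
  transport {P} {π} {π′} {f} em (pair {i} {j} i<j j<n adj o) (pi ∷ pj ∷ []) =
    pair (mono-< pi pj i<j) (in-range pj) (λ h → adjacent-f (adj h) pj) (order asc o)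
    where
    open Embedding em
    adjacent-f : ∀ {j} → j ≡ suc i → P j → f j ≡ suc (f i)
    adjacent-f refl pj = mono-suc pi pj
    order : ∀ c → Order c (π !! i) (π !! j) → Order c (π′ !! f i) (π′ !! f j)
    order true  = mono-!! pi pj
    order false = mono-!! pj pi
  transport {f = f} em (extend {is = is} {m = m} o below m<n refl) ps with All.++⁻ is ps
  ... | pis , (pm ∷ []) =
    extend (transport em o pis)
      (All.map⁺ (All.zipWith (λ (pi , (i<m , v)) → mono-< pi pm i<m , mono-!! pi pm v) (pis , below)))
      (in-range pm) (map-++ f is (m ∷ []))
    where open Embedding em

  module _ (A B : List ℕ) (bA : Bounded A) (bB : Bounded B) where

    private
      open Join A B bA bB
      a = length A
      b = length B
      w = join A B

      shift unshift : ℕ → ℕ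
      shift j = suc (a + j)
      -- Truncated subtraction, meaningful only on indices in `OnRight`.
      unshift i = i ∸ suc a

      unshift-shift : ∀ j → unshift (shift j) ≡ j
      unshift-shift j = ℕP.m+n∸m≡n a j

      OnRight : ℕ → Set
      OnRight i = ∃ λ j → j < b × i ≡ shift j

      embedA : Embedding (_< a) A w id
      embedA = record
        { in-range = left-length ; mono-< = λ _ _ h → h ; mono-suc = λ _ _ → refl ; mono-!! = left-<⁺ }

      restrictA : Embedding (_< a) w A id
      restrictA = record
        { in-range = id ; mono-< = λ _ _ h → h ; mono-suc = λ _ _ → refl ; mono-!! = left-<⁻ }

      embedB : Embedding (_< b) B w shift
      embedB = record
        { in-range = right-length
        ; mono-<   = λ _ _ h → s≤s (ℕP.+-monoʳ-< a h)
        ; mono-suc = λ {i} _ _ → cong suc (ℕP.+-suc a i)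
        ; mono-!!  = λ _ _ → right-<⁺ }

      restrictB : Embedding OnRight w B unshift
      restrictB = record
        { in-range = λ { (j , j<b , refl) → subst (_< b) (sym (unshift-shift j)) j<b }
        ; mono-<   = λ { (i , _ , refl) (j , _ , refl) h →
            subst₂ _<_ (sym (unshift-shift i)) (sym (unshift-shift j))
              (ℕP.+-cancelˡ-< (suc a) i j h) }
        ; mono-suc = λ { (i , _ , refl) (j , _ , e) →
            ℕP.+-∸-assoc 1 {shift i} {suc a} (ℕP.m≤m+n (suc a) i) }
        ; mono-!!  = λ { (i , _ , refl) (j , _ , refl) h →
            subst₂ (λ x y → B !! x < B !! y) (sym (unshift-shift i)) (sym (unshift-shift j))
              (right-<⁻ h) } }

      transport-id : ∀ {P π π′ e is} → Embedding P π π′ id → Occ π e is → All P is → Occ π′ e is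
      transport-id {is = is} em o ps = subst (Occ _ _) (map-id is) (transport em o ps)

      InLeft ThroughMax InRight : ℕ → List ℕ → Set
      InLeft e is = Occ A (suc e) is
      ThroughMax e is = ∃ λ is′ → Occ A e is′ × is ≡ is′ ∷ʳ a
      InRight e is = ∃ λ is′ → Occ B (suc e) is′ × is ≡ map shift is′

      -- The last index carries the largest letter, and its position decides. If it lies in A, all
      -- earlier indices do too. If it is the index of n, the earlier ones lie to the left of n,
      -- hence in A. If it lies in B, no earlier index can be at n or in A, where every letter
      -- exceeds those of B.
      split : ∀ e is → Occ w (suc e) is → (InLeft e is ⊎ ThroughMax e is) ⊎ InRight e is
      split e is (extend {is = is′} {m = m} o below m<n refl) with position a m
      ... | left m<a = inj₁ (inj₁ (transport-id restrictA (extend o below m<n refl)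
              (All.++⁺ (All.map (λ (i<m , _) → ℕP.<-trans i<m m<a) below) (m<a ∷ []))))
      ... | mid = inj₁ (inj₂ (is′ , transport-id restrictA o (All.map proj₁ below) , refl))
      ... | right j = inj₂ (map unshift is ,
              transport restrictB (extend o below m<n refl) onRight ,
              sym (trans (sym (map-∘ is)) (map-id-local (All.map shift-unshift onRight))))
        where
        j<b : j < b
        j<b = right-length⁻ m<n
        small⇒right : ∀ {i} → i < shift j × w !! i < w !! shift j → OnRight i
        small⇒right {i} (i<m , v) with position a i
        ... | left i<a = contradiction v (ℕP.<-asym (right<left i<a j<b))
        ... | mid      = contradiction v (ℕP.<-asym (right<mid j<b))
        ... | right i′ = i′ , ℕP.<-trans (ℕP.+-cancelˡ-< (suc a) i′ j i<m) j<b , refl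
        onRight : All OnRight is
        onRight = All.++⁺ (All.map small⇒right below) ((j , j<b , refl) ∷ [])
        shift-unshift : ∀ {i} → OnRight i → shift (unshift i) ≡ i
        shift-unshift (i , _ , refl) = cong shift (unshift-shift i)

      merge : ∀ e is → (InLeft e is ⊎ ThroughMax e is) ⊎ InRight e is → Occ w (suc e) is
      merge e is (inj₁ (inj₁ o)) = transport-id embedA o (occ-length o)
      merge e is (inj₁ (inj₂ (is′ , o , refl))) =
        extend (transport-id embedA o (occ-length o))
          (All.map (λ i<a → i<a , left<mid i<a) (occ-length o)) mid-length refl
      merge e is (inj₂ (is′ , o , refl)) = transport embedB o (occ-length o)

      left-max-disjoint : ∀ e is → InLeft e is → ¬ ThroughMax e is
      left-max-disjoint e is o (is′ , _ , refl) with All.++⁻ is′ (occ-length o)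
      ... | _ , (a<a ∷ []) = ℕP.<-irrefl refl a<a

      right-disjoint : ∀ e is → InLeft e is ⊎ ThroughMax e is → ¬ InRight e is
      right-disjoint e is h (is′ , o , refl) =
        absurd is′ o (lower h)
        where
        lower : InLeft e is ⊎ ThroughMax e is → All (_≤ a) is
        lower (inj₁ o) = All.map ℕP.<⇒≤ (occ-length o)
        lower (inj₂ (is″ , o , e)) = subst (All (_≤ a)) (sym e)
          (All.++⁺ (All.map ℕP.<⇒≤ (occ-length o)) (ℕP.≤-refl ∷ []))
        absurd : ∀ js → Occ B (suc e) js → All (_≤ a) (map shift js) → ⊥
        absurd []       o _       = occ-nonempty o
        absurd (j ∷ js) _ (p ∷ _) = ℕP.<⇒≱ (s≤s (ℕP.m≤m+n a j)) p

    card-join : ∀ {e x y z} → Card (Occ A (suc e)) x → Card (Occ A e) y → Card (Occ B (suc e)) z →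
      Card (Occ w (suc e)) (x + y + z)
    card-join {e} cx cy cz = card-resp (λ is → mk⇔ (merge e is) (split e is))
      (card-⊎ (right-disjoint e)
        (card-⊎ (left-max-disjoint e) cx (card-image (_∷ʳ a) (∷ʳ-injectiveˡ _ _) cy))
        (card-image (map shift) (map-injective (λ h → ℕP.+-cancelˡ-≡ (suc a) _ _ h)) cz))

  occ₀? : ∀ π is → Dec (Occ π 0 is)
  occ₀? π [] = no λ ()
  occ₀? π (_ ∷ []) = no λ ()
  occ₀? π (_ ∷ _ ∷ _ ∷ _) = no λ ()
  occ₀? π (i ∷ j ∷ []) = map′ (λ (p , q , r , s) → pair p q r s) (λ { (pair p q r s) → p , q , r , s })
    ((i <? j) ×-dec (j <? length π) ×-dec ((adjacent Bool.≟ true) →-dec (j ≟ suc i))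
      ×-dec order? asc (π !! i) (π !! j))

  private
    pairs : ∀ n → Card {List ℕ} (λ is → ∃₂ λ i j → is ≡ i ∷ j ∷ [] × i < n × j < n) _
    pairs n = card-product (λ i j → i ∷ j ∷ []) (λ { refl → refl , refl }) (below n) (below n)
      where
      below : ∀ n → Card (_< n) (length (upTo n))
      below n = upTo n , Unique.upTo⁺ n , (λ _ → mk⇔ ∈-upTo⁻ ∈-upTo⁺) , refl

    card₀ : ∀ π → ∃ (Card (Occ π 0))
    card₀ π with card-filter (occ₀? π) (pairs (length π))
    ... | c , card = c , card-resp (λ is → mk⇔ proj₂ λ { o@(pair i<j j<n _ _) →
      (_ , _ , refl , ℕP.<-trans i<j j<n , j<n) , o }) card

  -- Obtained by filtering all pairs of indices, so it evaluates on concrete trees: its values on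
  -- the leaf and the cherry are proved by `refl`.
  baseCount : Tree → ℕ
  baseCount t = proj₁ (card₀ (word true t))

  baseCount-card : ∀ t → Card (Occ (word true t) 0) (baseCount t)
  baseCount-card t = proj₂ (card₀ (word true t))

  no-occ-leaf : ∀ b e is → ¬ Occ (lastLeaf b) e is
  no-occ-leaf true  _ _ (pair (s≤s z≤n) (s≤s ()) _ _)
  no-occ-leaf false _ _ (pair _ () _ _)
  no-occ-leaf b     _ _ (extend o _ _ _) = no-occ-leaf b _ _ o

  -- The count does not depend on `b`, which is the source of ud(n+1) = uu(n). The recursion reads
  -- the base count only at left subtrees, whose words keep their last letter, and the rightmost
  -- leaf has no occurrence in either reading.
  word-card : ∀ b e t → Card (Occ (word b t) (suc e)) (occ baseCount (suc e) t)
  word-card b e leaf = card-empty (no-occ-leaf b (suc e))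
  word-card b zero (node s t) = card-join (word true s) (word b t) (word-bounded true s) (word-bounded b t)
    (word-card true zero s) (baseCount-card s) (word-card b zero t)
  word-card b (suc e) (node s t) = card-join (word true s) (word b t) (word-bounded true s) (word-bounded b t)
    (word-card true (suc e) s) (word-card true e s) (word-card b (suc e) t)

  contains⇔ : ∀ b e t c → ContainsExactly (tauTo (suc e)) (word b t) c ⇔ (occ baseCount (suc e) t ≡ c)
  contains⇔ b e t c = mk⇔
    (λ h → card-unique (λ is → ⇔-sym (occurrence⇔occ (suc e) (word b t) is)) (word-card b e t) h)
    (λ { refl → card-resp (λ is → ⇔-sym (occurrence⇔occ (suc e) (word b t) is)) (word-card b e t) })

-- Parity, 132-avoidance and alternation across a join.

parity : ∀ n → n % 2 ≡ 0 ⊎ n % 2 ≡ 1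
parity zero          = inj₁ refl
parity (suc zero)    = inj₂ refl
parity (suc (suc n)) = parity n

suc-even : ∀ n → n % 2 ≡ 0 → suc n % 2 ≡ 1
suc-even zero          _ = refl
suc-even (suc (suc n)) h = suc-even n h

suc-odd : ∀ n → n % 2 ≡ 1 → suc n % 2 ≡ 0
suc-odd (suc zero)    _ = refl
suc-odd (suc (suc n)) h = suc-odd n h

odd-shift : ∀ a i → a % 2 ≡ 1 → suc (a + i) % 2 ≡ i % 2
odd-shift (suc zero)    i _ = refl
odd-shift (suc (suc a)) i h = odd-shift a i h

0≢1 : ∀ {n} → n ≡ 0 → n ≢ 1
0≢1 refl ()

size-odd : ∀ t → size t % 2 ≡ 1
size-odd leaf       = refl
size-odd (node s t) = trans (odd-shift (size s) (size t) (size-odd s)) (size-odd t)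

No132 : List ℕ → Set
No132 π = ∀ i j k → i < j → j < k → k < length π → π !! i < π !! k → π !! k < π !! j → ⊥

avoids⇔no132 : ∀ π → Avoids p132 π ⇔ No132 π
avoids⇔no132 π = mk⇔ forth back
  where
  forth : Avoids p132 π → No132 π
  forth ([] , _ , m , _) i j k i<j j<k k<n x<z z<y = contradiction (from (m (i ∷ j ∷ k ∷ []))
    ( refl
    , (λ { 0 _ → ℕP.<-trans i<j (ℕP.<-trans j<k k<n) ; 1 _ → ℕP.<-trans j<k k<n ; 2 _ → k<n
         ; (suc (suc (suc _))) (s≤s (s≤s (s≤s ()))) })
    , (λ { 0 _ → i<j ; 1 _ → j<k ; (suc (suc _)) (s≤s (s≤s (s≤s ()))) })
    , order
    , (λ { 0 _ () ; 1 _ () ; (suc (suc _)) _ () }) ))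
    λ ()
    where
    x<y = ℕP.<-trans x<z z<y
    irr : ∀ {x y : ℕ} → (x < x) ⇔ (y < y)
    irr = mk⇔ (⊥-elim ∘ ℕP.<-irrefl refl) (⊥-elim ∘ ℕP.<-irrefl refl)
    yes′ : ∀ {P Q : Set} → P → Q → P ⇔ Q
    yes′ p q = mk⇔ (λ _ → q) (λ _ → p)
    no′ : ∀ {a b x y : ℕ} → b < a → y < x → (a < b) ⇔ (x < y)
    no′ p q = mk⇔ (⊥-elim ∘ ℕP.<-asym p) (⊥-elim ∘ ℕP.<-asym q)
    1<2 = s≤s (s≤s (z≤n {0}))
    1<3 = s≤s (s≤s (z≤n {1}))
    2<3 = s≤s (s≤s (s≤s (z≤n {0})))
    order : ∀ a b → a < 3 → b < 3 → (letters p132 !! a < letters p132 !! b)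
      ⇔ (π !! ((i ∷ j ∷ k ∷ []) !! a) < π !! ((i ∷ j ∷ k ∷ []) !! b))
    order 0 0 _ _ = irr
    order 0 1 _ _ = yes′ 1<3 x<y
    order 0 2 _ _ = yes′ 1<2 x<z
    order 1 0 _ _ = no′ 1<3 x<y
    order 1 1 _ _ = irr
    order 1 2 _ _ = no′ 2<3 z<y
    order 2 0 _ _ = no′ 1<2 x<z
    order 2 1 _ _ = yes′ 2<3 z<y
    order 2 2 _ _ = irr
    order (suc (suc (suc _))) _ (s≤s (s≤s (s≤s ()))) _
    order _ (suc (suc (suc _))) _ (s≤s (s≤s (s≤s ())))
  back : No132 π → Avoids p132 π
  back h = card-empty none
    where
    none : ∀ is → ¬ Occurrence p132 π is
    none (i ∷ j ∷ k ∷ []) (_ , bound , inc , ord , _) =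
      h i j k (inc 0 (s≤s (s≤s z≤n))) (inc 1 (s≤s (s≤s (s≤s z≤n)))) (bound 2 (s≤s (s≤s (s≤s z≤n))))
        (to (ord 0 2 (s≤s z≤n) (s≤s (s≤s (s≤s z≤n)))) (s≤s (s≤s z≤n)))
        (to (ord 2 1 (s≤s (s≤s (s≤s z≤n))) (s≤s (s≤s z≤n))) (s≤s (s≤s (s≤s z≤n))))

module JoinShape (A B : List ℕ) (bA : Bounded A) (bB : Bounded B) where

  open Join A B bA bB

  private
    a = length A
    b = length B
    w = join A B

    shift-suc : ∀ i → suc (suc (a + i)) ≡ suc (a + suc i)
    shift-suc i = cong suc (sym (ℕP.+-suc a i))

  -- The position of the letter that plays 2, at index k, decides. In A it pulls the other two into
  -- A. At the maximum it cannot be below the letter playing 3. In B it is smaller than everything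
  -- in A and than the maximum, so the letter playing 1 lies in B, and with it the one between.
  no132⁺ : No132 A → No132 B → No132 w
  no132⁺ hA hB i j k i<j j<k k<w x<z z<y with position a k
  ... | left k<a = hA i j k i<j j<k k<a (left-<⁻ i<a k<a x<z) (left-<⁻ k<a j<a z<y)
    where
    j<a = ℕP.<-trans j<k k<a
    i<a = ℕP.<-trans i<j j<a
  ... | mid = ℕP.<-asym z<y (left<mid j<k)
  ... | right k′ with position a i
  ...   | left i<a = ℕP.<-asym x<z (right<left i<a (right-length⁻ k<w))
  ...   | mid = ℕP.<-asym x<z (right<mid (right-length⁻ k<w))
  ...   | right i′ with position a j
  ...     | left j<a = ℕP.<-asym j<a (ℕP.<-trans (s≤s (ℕP.m≤m+n a i′)) i<j)
  ...     | mid = ℕP.<-asym i<j (s≤s (ℕP.m≤m+n a i′))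
  ...     | right j′ = hB i′ j′ k′ (ℕP.+-cancelˡ-< (suc a) i′ j′ i<j) (ℕP.+-cancelˡ-< (suc a) j′ k′ j<k)
                         (right-length⁻ k<w) (right-<⁻ x<z) (right-<⁻ z<y)

  no132⁻ : No132 w → No132 A × No132 B
  no132⁻ h =
    (λ i j k i<j j<k k<a x<z z<y →
      let j<a = ℕP.<-trans j<k k<a ; i<a = ℕP.<-trans i<j j<a in
      h i j k i<j j<k (left-length k<a) (left-<⁺ i<a k<a x<z) (left-<⁺ k<a j<a z<y)) ,
    (λ i j k i<j j<k k<b x<z z<y →
      h (suc (a + i)) (suc (a + j)) (suc (a + k)) (s≤s (ℕP.+-monoʳ-< a i<j)) (s≤s (ℕP.+-monoʳ-< a j<k))
        (right-length k<b) (right-<⁺ x<z) (right-<⁺ z<y))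

  -- Indices start at 0, so peaks have odd index. With |A| odd the maximum sits on a peak, and B
  -- begins at an even index and keeps its phase.
  alternating⁺ : a % 2 ≡ 1 → Alternating A → Alternating B → Alternating w
  alternating⁺ odd hA hB j j<w with position a j
  ... | left j<a with ℕP.m≤n⇒m<n∨m≡n j<a
  ...   | inj₁ sj<a = left-<⁺ j<a sj<a ∘ proj₁ (hA j sj<a) , left-<⁺ sj<a j<a ∘ proj₂ (hA j sj<a)
  ...   | inj₂ sj≡a = (λ _ → subst (λ m → w !! j < w !! m) (sym sj≡a) (left<mid j<a)) ,
            λ h → contradiction (trans (cong (_% 2) sj≡a) odd) (0≢1 (suc-odd j h))
  alternating⁺ odd hA hB j j<w | mid = (λ h → contradiction odd (0≢1 h)) ,
    λ _ → subst (λ m → w !! suc m < w !! a) (ℕP.+-identityʳ a)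
      (right<mid (right-length⁻ (subst (λ m → suc m < length w) (sym (ℕP.+-identityʳ a)) j<w)))
  alternating⁺ odd hA hB j j<w | right i =
    (λ h → subst (λ m → w !! suc (a + i) < w !! m) (sym (shift-suc i))
             (right-<⁺ (proj₁ hi (trans (sym (odd-shift a i odd)) h)))) ,
    (λ h → subst (λ m → w !! m < w !! suc (a + i)) (sym (shift-suc i))
             (right-<⁺ (proj₂ hi (trans (sym (odd-shift a i odd)) h))))
    where hi = hB i (right-length⁻ (subst (_< length w) (shift-suc i) j<w))

  alternating⁻ : a % 2 ≡ 1 → Alternating w → Alternating A × Alternating B
  alternating⁻ odd h =
    (λ j sj<a → let j<a = ℕP.<-trans (ℕP.n<1+n j) sj<a ; hj = h j (left-length sj<a) in
      left-<⁻ j<a sj<a ∘ proj₁ hj , left-<⁻ sj<a j<a ∘ proj₂ hj) ,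
    (λ j sj<b → let hj = h (suc (a + j)) (subst (_< length w) (sym (shift-suc j)) (right-length sj<b)) in
      (λ p → right-<⁻ (subst (λ m → w !! suc (a + j) < w !! m) (shift-suc j)
               (proj₁ hj (trans (odd-shift a j odd) p)))) ,
      (λ p → right-<⁻ (subst (λ m → w !! m < w !! suc (a + j)) (shift-suc j)
               (proj₂ hj (trans (odd-shift a j odd) p)))))

  -- The maximum must be a peak. At index 0 it would be followed by an ascent, and at a positive
  -- even index it would be preceded by a descent.
  left-odd : 2 ≤ length w → Alternating w → a % 2 ≡ 1
  left-odd 2≤w h = go a refl
    where
    go : ∀ a′ → a ≡ a′ → a′ % 2 ≡ 1
    go zero eq = contradiction (≤mid 2≤w)
      (ℕP.<⇒≱ (subst (λ m → w !! m < w !! 1) (sym eq) (proj₁ (h 0 2≤w) refl)))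
    go (suc a′) eq with parity a′
    ... | inj₁ even = suc-even a′ even
    ... | inj₂ odd  = contradiction (proj₂ (h a′ (subst (_< length w) eq mid-length)) odd)
      (ℕP.<-asym (subst (λ m → w !! a′ < w !! m) eq (left<mid (ℕP.≤-reflexive (sym eq)))))

-- Permutations as duplicate-free words with prescribed letters.

isPerm-length : ∀ {n π} → IsPerm n π → length π ≡ n
isPerm-length {n} p = trans (↭-length p) (trans (length-map suc (upTo n)) (length-upTo n))

range-∈ : ∀ n x → x ∈ map suc (upTo n) ⇔ (1 ≤ x × x ≤ n)
range-∈ n x = mk⇔
  (λ x∈ → let y , y∈ , e = ∈-map⁻ suc x∈ in
    subst (λ x → 1 ≤ x × x ≤ n) (sym e) (s≤s z≤n , ∈-upTo⁻ y∈))
  (λ { (s≤s _ , x≤n) → ∈-map⁺ suc (∈-upTo⁺ x≤n) })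

range-unique : ∀ n → Unique (map suc (upTo n))
range-unique n = Unique.map⁺ ℕP.suc-injective (Unique.upTo⁺ n)

isPerm-∈ : ∀ {n π} → IsPerm n π → ∀ x → x ∈ π ⇔ (1 ≤ x × x ≤ n)
isPerm-∈ {n} p x = ⇔-trans (mk⇔ (∈-resp-↭ p) (∈-resp-↭ (↭-sym p))) (range-∈ n x)

isPerm-unique : ∀ {n π} → IsPerm n π → Unique π
isPerm-unique {n} p = PermutationSetoid.Unique-resp-↭ (≡.setoid ℕ) (↭⇒↭ₛ (↭-sym p)) (range-unique n)

isPerm-intro : ∀ {n π} → Unique π → (∀ x → x ∈ π ⇔ (1 ≤ x × x ≤ n)) → IsPerm n π
isPerm-intro {n} u m = unique∧set⇒↭ u (range-unique n) λ x → ⇔-trans (m x) (⇔-sym (range-∈ n x))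

isPerm-bounded : ∀ {π} → IsPerm (length π) π → Bounded π
isPerm-bounded {π} p i i<n = to (isPerm-∈ p _) (!!-∈ π i<n)

∈-bounds : ∀ {π x} → Bounded π → x ∈ π → 1 ≤ x × x ≤ length π
∈-bounds {π} bπ x∈ = let i , i<n , e = ∈-!! x∈ in subst (λ x → 1 ≤ x × x ≤ length π) e (bπ i i<n)

join-isPerm : ∀ A B → IsPerm (length A) A → IsPerm (length B) B → IsPerm (length (join A B)) (join A B)
join-isPerm A B pA pB = isPerm-intro unique member
  where
  a = length A
  b = length B
  top = suc (a + b)
  bounded = Join.bounded A B (isPerm-bounded pA) (isPerm-bounded pB)
  unique : Unique (join A B)
  unique = Unique.++⁺ (Unique.map⁺ (λ {x} {y} → ℕP.+-cancelʳ-≡ b x y) (isPerm-unique pA))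
    (All.tabulate (λ {x} x∈B e → ℕP.<-irrefl (sym e)
      (s≤s (ℕP.≤-trans (proj₂ (to (isPerm-∈ pB x) x∈B)) (ℕP.m≤n+m b a)))) ∷ isPerm-unique pB)
    disjoint
    where
    disjoint : ∀ {x} → x ∈ map (_+ b) A × x ∈ top ∷ B → ⊥
    disjoint (x∈A , x∈B) with ∈-map⁻ (_+ b) x∈A
    disjoint (x∈A , here e) | y , y∈ , refl =
      ℕP.<-irrefl e (s≤s (ℕP.+-monoˡ-≤ b (proj₂ (to (isPerm-∈ pA y) y∈))))
    disjoint (x∈A , there x∈B) | y , y∈ , refl =
      ℕP.<⇒≱ (ℕP.+-monoˡ-≤ b (proj₁ (to (isPerm-∈ pA y) y∈))) (proj₂ (to (isPerm-∈ pB _) x∈B))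
  member : ∀ x → x ∈ join A B ⇔ (1 ≤ x × x ≤ length (join A B))
  member x = mk⇔ (∈-bounds bounded) find
    where
    find : 1 ≤ x × x ≤ length (join A B) → x ∈ join A B
    find (1≤x , x≤) with x ℕ.≤? b
    ... | yes x≤b = ∈-++⁺ʳ (map (_+ b) A) (there (from (isPerm-∈ pB x) (1≤x , x≤b)))
    ... | no x≰b with ℕP.m≤n⇒m<n∨m≡n (subst (x ≤_) (length-join A B) x≤)
    ...   | inj₂ refl = ∈-++⁺ʳ (map (_+ b) A) (here refl)
    ...   | inj₁ (s≤s x≤a+b) = ∈-++⁺ˡ (subst (_∈ map (_+ b) A) (ℕP.m∸n+n≡m (ℕP.<⇒≤ b<x))
              (∈-map⁺ (_+ b) (from (isPerm-∈ pA (x ∸ b))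
                (ℕP.m<n⇒0<n∸m b<x , ℕP.m≤n+o⇒m∸n≤o x b (subst (x ≤_) (ℕP.+-comm a b) x≤a+b)))))
      where b<x = ℕP.≰⇒> x≰b

-- The bijection between trees and alternating 132-avoiding permutations.

word-isPerm : ∀ b t → IsPerm (length (word b t)) (word b t)
word-isPerm true  leaf = isPerm-intro ([] ∷ [])
  λ x → mk⇔ (λ { (here refl) → s≤s z≤n , s≤s z≤n }) (λ { (s≤s z≤n , s≤s z≤n) → here refl })
word-isPerm false leaf = isPerm-intro []
  λ x → mk⇔ (λ ()) (λ { (s≤s _ , ()) })
word-isPerm b (node s t) = join-isPerm (word true s) (word b t) (word-isPerm true s) (word-isPerm b t)

word-odd : ∀ t → length (word true t) % 2 ≡ 1
word-odd t = trans (cong (_% 2) (length-word t)) (size-odd t)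

word-alternating : ∀ b t → Alternating (word b t)
word-alternating true  leaf j (s≤s ())
word-alternating false leaf j ()
word-alternating b (node s t) = JoinShape.alternating⁺ (word true s) (word b t)
  (word-bounded true s) (word-bounded b t) (word-odd s) (word-alternating true s) (word-alternating b t)

word-no132 : ∀ b t → No132 (word b t)
word-no132 true  leaf _ _ zero    _ () _ _ _
word-no132 true  leaf _ _ (suc _) _ _ (s≤s ()) _ _
word-no132 false leaf _ _ _ _ _ () _ _
word-no132 b (node s t) = JoinShape.no132⁺ (word true s) (word b t)
  (word-bounded true s) (word-bounded b t) (word-no132 true s) (word-no132 b t)

++-injective : ∀ (xs ys : List ℕ) {us vs} → length xs ≡ length ys → xs ++ us ≡ ys ++ vs → xs ≡ ys × us ≡ vs
++-injective []       []       _ e = refl , e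
++-injective (x ∷ xs) (y ∷ ys) l e with ∷-injective e
... | refl , e′ = map₁ (cong (x ∷_)) (++-injective xs ys (ℕP.suc-injective l) e′)

-- The maximal letter occurs at only one index, so equal words force |A| = |C|. The lengths then fix
-- |B|, and both blocks can be read off.
join-injective : ∀ A B C D → Bounded A → Bounded B → join A B ≡ join C D → A ≡ C × B ≡ D
join-injective A B C D bA bB e =
  map-injective (λ {x} {y} → ℕP.+-cancelʳ-≡ b x y) A′≡ , proj₂ (∷-injective (proj₂ parts))
  where
  open Join A B bA bB
  a = length A
  b = length B
  c = length C
  w = join A B
  lengths : suc (a + b) ≡ suc (c + length D)
  lengths = trans (sym (length-join A B)) (trans (cong length e) (length-join C D))
  c<w : c < length w
  c<w = subst (c <_) (sym (trans (cong length e) (length-join C D))) (s≤s (ℕP.m≤m+n c _))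
  same-max : w !! c ≡ w !! a
  same-max = trans (cong (_!! c) e) (trans (join-mid C D) (trans (sym lengths) (sym (join-mid A B))))
  a≡c : a ≡ c
  a≡c = go (position a c) refl
    where
    go : ∀ {i} → Position a i → i ≡ c → a ≡ c
    go mid        i≡c  = i≡c
    go (left i<a) refl = contradiction same-max (ℕP.<⇒≢ (left<mid i<a))
    go (right j)  i≡c  = contradiction (trans (cong (w !!_) i≡c) same-max)
      (ℕP.<⇒≢ (right<mid (right-length⁻ (subst (_< length w) (sym i≡c) c<w))))
  b≡d : b ≡ length D
  b≡d = ℕP.+-cancelˡ-≡ a b (length D) (trans (ℕP.suc-injective lengths) (cong (_+ length D) (sym a≡c)))
  parts : map (_+ b) A ≡ map (_+ length D) C × suc (a + b) ∷ B ≡ suc (c + length D) ∷ D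
  parts = ++-injective (map (_+ b) A) (map (_+ length D) C)
    (trans (length-map _ A) (trans a≡c (sym (length-map _ C)))) e
  A′≡ : map (_+ b) A ≡ map (_+ b) C
  A′≡ = trans (proj₁ parts) (cong (λ m → map (_+ m) C) (sym b≡d))

length-node : ∀ b s t → 2 ≤ length (word b (node s t))
length-node b s t = subst (2 ≤_) (sym (length-join (word true s) (word b t)))
  (s≤s (ℕP.m≤n⇒m≤n+o _ (subst (1 ≤_) (sym (length-word s)) (ℕP.n≢0⇒n>0 (size≢0 s)))))

length-leaf : ∀ b → length (lastLeaf b) ≤ 1
length-leaf true  = s≤s z≤n
length-leaf false = z≤n

word-injective : ∀ b {t u} → word b t ≡ word b u → t ≡ u
word-injective b {leaf} {leaf} _ = refl
word-injective b {leaf} {node s t} e =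
  contradiction (length-leaf b) (ℕP.<⇒≱ (subst (λ w → 2 ≤ length w) (sym e) (length-node b s t)))
word-injective b {node s t} {leaf} e =
  contradiction (length-leaf b) (ℕP.<⇒≱ (subst (λ w → 2 ≤ length w) e (length-node b s t)))
word-injective b {node s t} {node u v} e
  with join-injective (word true s) (word b t) (word true u) (word b v) (word-bounded true s) (word-bounded b t) e
... | p , q = cong₂ node (word-injective true p) (word-injective b q)

unique-++⁻ : ∀ (xs : List ℕ) {ys} → Unique (xs ++ ys) →
  Unique xs × Unique ys × (∀ {x} → x ∈ xs → x ∉ ys)
unique-++⁻ []       u = [] , u , λ ()
unique-++⁻ (x ∷ xs) (x∉ ∷ u) with unique-++⁻ xs u | All.++⁻ xs x∉
... | uxs , uys , disjoint | x∉xs , x∉ys = x∉xs ∷ uxs , uys ,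
  λ { (here refl) y∈ → All.lookup x∉ys y∈ refl ; (there x∈) → disjoint x∈ }

upper-bound : ∀ xs → ∃ λ m → (∀ {x} → x ∈ xs → x ≤ m) × (m ∈ xs ⊎ m ≡ 0)
upper-bound [] = 0 , (λ ()) , inj₂ refl
upper-bound (x ∷ xs) with upper-bound xs
... | m , ≤m , attained with ℕP.≤-total x m
...   | inj₁ x≤m = m , (λ { (here refl) → x≤m ; (there y∈) → ≤m y∈ }) , [ inj₁ ∘ there , inj₂ ]′ attained
...   | inj₂ m≤x = x , (λ { (here refl) → ℕP.≤-refl ; (there y∈) → ℕP.≤-trans (≤m y∈) m≤x }) , inj₁ (here refl)

-- Downward closure fills the whole range from 1 to the largest letter, so that letter equals the
-- length. For the empty word the bound is 0. This yields that the block B is a permutation without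
-- counting its letters.
downset-isPerm : ∀ {π} → Unique π → (∀ {x} → x ∈ π → 1 ≤ x) →
  (∀ {x y} → y ∈ π → 1 ≤ x → x ≤ y → x ∈ π) → IsPerm (length π) π
downset-isPerm {π} u pos down with upper-bound π
... | m , ≤m , attained = subst (λ n → IsPerm n π) (sym (isPerm-length perm)) perm
  where
  fill : ∀ {x} → m ∈ π ⊎ m ≡ 0 → 1 ≤ x × x ≤ m → x ∈ π
  fill (inj₁ m∈)   (1≤x , x≤m) = down m∈ 1≤x x≤m
  fill (inj₂ refl) (1≤x , x≤m) = contradiction (ℕP.≤-trans 1≤x x≤m) λ ()
  perm : IsPerm m π
  perm = isPerm-intro u λ x → mk⇔ (λ x∈ → pos x∈ , ≤m x∈) (fill attained)

decompose : ∀ {n π} → 1 ≤ n → IsPerm n π → No132 π →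
  ∃₂ λ A B → π ≡ join A B × IsPerm (length A) A × IsPerm (length B) B
decompose {n} {π} 1≤n p no132 with ∈-∃++ (from (isPerm-∈ p n) (1≤n , ℕP.≤-refl))
... | A′ , B , refl with unique-++⁻ A′ (isPerm-unique p)
...   | uA′ , (n∉B ∷ uB) , disjoint = A , B , whole , pA , pB
  where
  b = length B
  -- All letters of `A′` exceed `b` (see `b<A′`), so the truncated subtraction can be undone.
  A = map (_∸ b) A′

  bounds : ∀ {x} → x ∈ π → 1 ≤ x × x ≤ n
  bounds = to (isPerm-∈ p _)

  B-in : ∀ {x} → x ∈ B → x ∈ π
  B-in = ∈-++⁺ʳ A′ ∘ there

  B<n : ∀ {x} → x ∈ B → x < n
  B<n x∈ = ℕP.≤∧≢⇒< (proj₂ (bounds (B-in x∈))) λ { refl → All.lookup n∉B x∈ refl }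

  -- Otherwise x, n, y would form a 132.
  B<A′ : ∀ {x y} → x ∈ A′ → y ∈ B → y < x
  B<A′ {x} {y} x∈ y∈ with ℕP.<-cmp x y
  ... | tri> _ _ y<x = y<x
  ... | tri≈ _ refl _ = contradiction (there y∈) (disjoint x∈)
  ... | tri< x<y _ _ with ∈-!! x∈ | ∈-!! y∈
  ...   | i , i< , refl | j , j< , refl = ⊥-elim (no132 i (length A′) (length A′ + suc j) i<
            (ℕP.m<m+n (length A′) (s≤s z≤n))
            (subst (length A′ + suc j <_) (sym (length-++ A′)) (ℕP.+-monoʳ-< (length A′) (s≤s j<)))
            (subst₂ _<_ (sym (!!-++ˡ A′ i<)) (sym (!!-++ʳ A′ (suc j))) x<y)
            (subst₂ _<_ (sym (!!-++ʳ A′ (suc j)))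
              (sym (trans (cong (π !!_) (sym (ℕP.+-identityʳ (length A′)))) (!!-++ʳ A′ 0))) (B<n y∈)))

  down : ∀ {x y} → y ∈ B → 1 ≤ x → x ≤ y → x ∈ B
  down {x} {y} y∈ 1≤x x≤y
    with ∈-++⁻ A′ (from (isPerm-∈ p x) (1≤x , ℕP.≤-trans x≤y (ℕP.<⇒≤ (B<n y∈))))
  ... | inj₁ x∈A′         = contradiction x≤y (ℕP.<⇒≱ (B<A′ x∈A′ y∈))
  ... | inj₂ (here refl)  = contradiction x≤y (ℕP.<⇒≱ (B<n y∈))
  ... | inj₂ (there x∈B)  = x∈B

  pB : IsPerm b B
  pB = downset-isPerm uB (proj₁ ∘ bounds ∘ B-in) down

  n≡ : n ≡ suc (length A′ + b)
  n≡ = trans (sym (isPerm-length p)) (trans (length-++ A′) (ℕP.+-suc (length A′) b))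

  b<A′ : ∀ {x} → x ∈ A′ → b < x
  b<A′ {x} x∈ with b ℕ.<? x
  ... | yes b<x = b<x
  ... | no b≮x = contradiction
    (there (from (isPerm-∈ pB x) (proj₁ (bounds (∈-++⁺ˡ x∈)) , ℕP.≮⇒≥ b≮x))) (disjoint x∈)

  A′≡ : map (_+ b) A ≡ A′
  A′≡ = trans (sym (map-∘ A′)) (map-id-local (All.tabulate λ x∈ → ℕP.m∸n+n≡m (ℕP.<⇒≤ (b<A′ x∈))))

  |A| : length A ≡ length A′
  |A| = length-map (_∸ b) A′

  member : ∀ y → y ∈ A ⇔ (1 ≤ y × y ≤ length A)
  member y = mk⇔ forth back
    where
    forth : y ∈ A → 1 ≤ y × y ≤ length A
    forth y∈ with ∈-map⁻ (_∸ b) y∈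
    ... | x , x∈ , refl = ℕP.m<n⇒0<n∸m (b<A′ x∈) , ℕP.m≤n+o⇒m∸n≤o x b
      (subst (x ≤_) (trans (cong (_+ b) (sym |A|)) (ℕP.+-comm (length A) b)) x≤)
      where
      x<n : x < n
      x<n = ℕP.≤∧≢⇒< (proj₂ (bounds (∈-++⁺ˡ x∈))) λ { refl → disjoint x∈ (here refl) }
      x≤ : x ≤ length A′ + b
      x≤ = ℕP.≤-pred (subst (x <_) n≡ x<n)
    back : 1 ≤ y × y ≤ length A → y ∈ A
    back (1≤y , y≤)
      with ∈-++⁻ A′ (from (isPerm-∈ p (y + b)) (ℕP.m≤n⇒m≤n+o b 1≤y , ℕP.<⇒≤ y+b<n))
      where
      y+b<n : y + b < n
      y+b<n = subst (y + b <_) (sym n≡) (s≤s (ℕP.+-monoˡ-≤ b (subst (y ≤_) |A| y≤)))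
    ... | inj₁ ∈A′ = subst (_∈ A) (ℕP.m+n∸n≡m y b) (∈-map⁺ (_∸ b) ∈A′)
    ... | inj₂ (here e) = contradiction (subst (y ≤_) |A| y≤)
            (ℕP.<⇒≱ (ℕP.+-cancelʳ-< b (length A′) y (ℕP.≤-reflexive (sym (trans e n≡)))))
    ... | inj₂ (there ∈B) =
            contradiction (proj₂ (to (isPerm-∈ pB _) ∈B)) (ℕP.<⇒≱ (ℕP.+-monoˡ-≤ b 1≤y))

  pA : IsPerm (length A) A
  pA = isPerm-intro (Unique.map⁻ (subst Unique (sym A′≡) uA′)) member

  whole : π ≡ join A B
  whole = cong₂ _++_ (sym A′≡) (cong (_∷ B) (trans n≡ (cong (λ m → suc (m + b)) (sym |A|))))

parityOf : Bool → ℕ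
parityOf true  = 1
parityOf false = 0

word-parity : ∀ b t → length (word b t) % 2 ≡ parityOf b
word-parity true  leaf = refl
word-parity false leaf = refl
word-parity b (node s t) = trans (cong (_% 2) (length-join (word true s) (word b t)))
  (trans (odd-shift (length (word true s)) (length (word b t)) (word-odd s)) (word-parity b t))

-- The blocks delivered by `decompose` are not subterms of π, so the recursion runs on the bound `m`
-- of the length. `left-odd` makes A odd, as a left subtree requires, and B inherits the parity of
-- π.
word-surjective : ∀ m b π → length π ≤ m → length π % 2 ≡ parityOf b →
  IsPerm (length π) π → Alternating π → No132 π → ∃ λ t → word b t ≡ π
word-surjective m false [] _ _ _ _ _ = leaf , refl
word-surjective m true (x ∷ []) _ _ p _ _ with isPerm-bounded p 0 (s≤s z≤n)
... | s≤s z≤n , s≤s z≤n = leaf , refl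
word-surjective (suc m) b π@(_ ∷ _ ∷ _) (s≤s l) par p alt no132 with decompose (s≤s z≤n) p no132
... | A , B , e , pA , pB = node (proj₁ left′) (proj₁ right′) ,
        trans (cong₂ join (proj₂ left′) (proj₂ right′)) (sym e)
  where
  bA = isPerm-bounded pA
  bB = isPerm-bounded pB
  open JoinShape A B bA bB
  π-length : length π ≡ suc (length A + length B)
  π-length = trans (cong length e) (length-join A B)
  A-odd : length A % 2 ≡ 1
  A-odd = left-odd (subst (λ w → 2 ≤ length w) e (s≤s (s≤s z≤n))) (subst Alternating e alt)
  A+B≤m : length A + length B ≤ m
  A+B≤m = ℕP.≤-pred (subst (_≤ suc m) π-length (s≤s l))
  alts = alternating⁻ A-odd (subst Alternating e alt)
  no132s = no132⁻ (subst No132 e no132)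
  left′ = word-surjective m true A (ℕP.m+n≤o⇒m≤o (length A) A+B≤m) A-odd pA (proj₁ alts) (proj₁ no132s)
  right′ = word-surjective m b B (ℕP.m+n≤o⇒n≤o (length A) A+B≤m)
    (trans (sym (odd-shift (length A) (length B) A-odd)) (trans (cong (_% 2) (sym π-length)) par))
    pB (proj₂ alts) (proj₂ no132s)

size≥3 : ∀ t → t ≢ leaf → 3 ≤ size t
size≥3 leaf       h = contradiction refl h
size≥3 (node s t) _ = s≤s (ℕP.+-mono-≤ (ℕP.n≢0⇒n>0 (size≢0 s)) (ℕP.n≢0⇒n>0 (size≢0 t)))

-- From trees back to the series of the theorem.

module _ (asc adjacent : Bool) where
  open Patterns asc adjacent

  -- A word of length at least 5 has ascents at indices 0, 1 and 2, 3, and descents at 1, 2 and 3,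
  -- 4. These pairs are adjacent, so they count whether or not adjacency is demanded.
  baseCount-large : ∀ s t → s ≢ leaf ⊎ t ≢ leaf → 2 ≤ baseCount (node s t)
  baseCount-large s t h = go asc refl
    where
    π = word true (node s t)
    alt = word-alternating true (node s t)
    1≤size : ∀ t → 1 ≤ size t
    1≤size t = ℕP.n≢0⇒n>0 (size≢0 t)
    large : 5 ≤ length π
    large = subst (5 ≤_) (sym (length-word (node s t))) (s≤s
      ([ (λ s≢ → ℕP.+-mono-≤ (size≥3 s s≢) (1≤size t)) , (λ t≢ → ℕP.+-mono-≤ (1≤size s) (size≥3 t t≢)) ]′ h))
    n≥ : ∀ {m} → m ≤ 5 → m ≤ length π
    n≥ p = ℕP.≤-trans p large
    2≤5 = s≤s (s≤s (z≤n {3}))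
    3≤5 = s≤s (s≤s (s≤s (z≤n {2})))
    4≤5 = s≤s (s≤s (s≤s (s≤s (z≤n {1}))))
    order : ∀ {x y} → asc ≡ true → x < y → Order asc x y
    order refl p = p
    order′ : ∀ {x y} → asc ≡ false → y < x → Order asc x y
    order′ refl p = p
    go : ∀ c → asc ≡ c → 2 ≤ baseCount (node s t)
    go true e = card-≥2 {x = 0 ∷ 1 ∷ []} {2 ∷ 3 ∷ []} (λ ())
      (pair (ℕP.n<1+n _) (n≥ 2≤5) (λ _ → refl) (order e (proj₁ (alt 0 (n≥ 2≤5)) refl)))
      (pair (ℕP.n<1+n _) (n≥ 4≤5) (λ _ → refl) (order e (proj₁ (alt 2 (n≥ 4≤5)) refl)))
      (baseCount-card (node s t))
    go false e = card-≥2 {x = 1 ∷ 2 ∷ []} {3 ∷ 4 ∷ []} (λ ())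
      (pair (ℕP.n<1+n _) (n≥ 3≤5) (λ _ → refl) (order′ e (proj₂ (alt 1 (n≥ 3≤5)) refl)))
      (pair (ℕP.n<1+n _) large (λ _ → refl) (order′ e (proj₂ (alt 3 large) refl)))
      (baseCount-card (node s t))

  module _ (e : ℕ) where

    Shape : Bool → ℕ → List ℕ → Set
    Shape b n π = IsPerm n π × ((2 ≤ n) × (n % 2 ≡ parityOf b) × Alternating π) × Avoids p132 π ×
      ContainsExactly (tauTo (suc e)) π 1

    shape⇔ : ∀ b n π → Shape b n π ⇔
      (∃ λ t → (length (word b t) ≡ n × occ baseCount (suc e) t ≡ 1) × π ≡ word b t)
    shape⇔ b n π = mk⇔ forth back
      where
      forth : Shape b n π → _
      forth (p , (_ , par , alt) , av , c) with isPerm-length p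
      ... | refl with word-surjective n b π ℕP.≤-refl par p alt (to (avoids⇔no132 π) av)
      ...   | t , refl = t , (refl , to (contains⇔ b e t 1) c) , refl
      back : _ → Shape b n π
      -- Requiring `2 ≤ n` excludes only the leaf, which has no occurrence anyway.
      back (leaf , (_ , ()) , _)
      back (t@(node u v) , (refl , c) , refl) =
        word-isPerm b t ,
        (length-node b u v , word-parity b t , word-alternating b t) ,
        from (avoids⇔no132 (word b t)) (word-no132 b t) ,
        from (contains⇔ b e t 1) c

    count-shape : ∀ b n {c} → HasExactly (Shape b n) c →
      ∀ {d} → Card (λ t → length (word b t) ≡ n × occ baseCount (suc e) t ≡ 1) d → c ≡ d
    count-shape b n h cd = card-unique (shape⇔ b n) h (card-image (word b) (word-injective b) cd)

  module _ (g-cherry : baseCount (node leaf leaf) ≡ 1) (e : ℕ) (ud uu : ℕ → ℕ)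
    (hud : ∀ n → HasExactly (Shape e true n) (ud n)) (huu : ∀ n → HasExactly (Shape e false n) (uu n)) where

    private
      m = 2 + e
      c = + (2 ^ (2 * m))

      closed : (onceSeries baseCount (suc e) ⊛ chebW m) ⊛ chebW m ≈ mono c (suc (2 * m))
      closed = onceSeries-closed baseCount refl g-cherry baseCount-large (suc e)

      card : ∀ n → Card (λ t → size t ≡ n × occ baseCount (suc e) t ≡ 1) _
      card = countOfSize-card (λ t → occ baseCount (suc e) t ≡ 1) (λ t → occ baseCount (suc e) t ≟ 1)

    ud-once : ofℕ ud ≈ onceSeries baseCount (suc e)
    ud-once n = cong +_ (count-shape e true n (hud n) (card-resp
      (λ t → mk⇔ (λ (p , q) → trans (length-word t) p , q) (λ (p , q) → trans (sym (length-word t)) p , q))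
      (card n)))

    -- An up-up word is one letter shorter than its tree is large, and the factor `X` makes up for
    -- the dropped letter.
    uu-once : X ⊛ ofℕ uu ≈ onceSeries baseCount (suc e)
    uu-once n = trans (X-⊛ (ofℕ uu) n) (go n)
      where
      go : ∀ n → shiftT (ofℕ uu) n ≡ onceSeries baseCount (suc e) n
      go zero    = cong +_ (card-unique (λ t → mk⇔ (λ ()) λ (p , _) → size≢0 t p) (card-empty {P = λ _ → ⊥} λ _ ()) (card 0))
      go (suc n) = cong +_ (count-shape e false n (huu n) (card-resp
        (λ t → mk⇔ (λ (p , q) → ℕP.suc-injective (trans (length-word-false t) p) , q)
                   (λ (p , q) → trans (sym (length-word-false t)) (cong suc p) , q))
        (card (suc n))))

    ud-series : (ofℕ ud ⊛ chebW m) ⊛ chebW m ≈ mono c (suc (2 * m))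
    ud-series n = trans (⊛-cong {g = chebW m} (⊛-cong {g = chebW m} ud-once (λ _ → refl)) (λ _ → refl) n) (closed n)

    -- Multiplication by `X` shifts coefficients, so comparing the identity for `X ⊛ ofℕ uu` at
    -- index `suc n` amounts to dividing by `X`.
    uu-series : (ofℕ uu ⊛ chebW m) ⊛ chebW m ≈ mono c (2 * m)
    uu-series n = begin
      F n                                           ≡⟨ X-⊛ F (suc n) ⟨
      (X ⊛ F) (suc n)                               ≡⟨ ⊛-assoc X (ofℕ uu ⊛ W) W (suc n) ⟨
      ((X ⊛ (ofℕ uu ⊛ W)) ⊛ W) (suc n)
        ≡⟨ ⊛-cong {X ⊛ (ofℕ uu ⊛ W)} {g = W} (λ i → sym (⊛-assoc X (ofℕ uu) W i)) (λ _ → refl) (suc n) ⟩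
      (((X ⊛ ofℕ uu) ⊛ W) ⊛ W) (suc n)
        ≡⟨ ⊛-cong {(X ⊛ ofℕ uu) ⊛ W} {g = W} (⊛-cong {g = W} uu-once (λ _ → refl)) (λ _ → refl) (suc n) ⟩
      ((onceSeries baseCount (suc e) ⊛ W) ⊛ W) (suc n) ≡⟨ closed (suc n) ⟩
      mono c (suc (2 * m)) (suc n)                  ≡⟨ tail-mono c (2 * m) n ⟩
      mono c (2 * m) n                              ∎
      where
      open ≡-Reasoning
      W = chebW m
      F = (ofℕ uu ⊛ W) ⊛ W

-- The classical pattern 2-1-3-⋯-k.

module _ where
  open Patterns false false

  -- The first letter and the maximum both exceed the letter following the maximum.
  inversions≢1 : ∀ t → baseCount t ≢ 1
  inversions≢1 leaf ()
  inversions≢1 (node s t) = ℕP.>⇒≢ (card-≥2 (λ { h → ℕP.<⇒≢ 0<a (proj₁ (∷-injective h)) })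
    (pair (s≤s z≤n) (right-length 0<b) (λ ()) (right<left 0<a 0<b))
    (pair (s≤s (ℕP.m≤m+n (length A) 0)) (right-length 0<b) (λ ()) (right<mid 0<b))
    (baseCount-card (node s t)))
    where
    A = word true s
    B = word true t
    open Join A B (word-bounded true s) (word-bounded true t)
    0<a : 0 < length A
    0<a = subst (0 <_) (sym (length-word s)) (ℕP.n≢0⇒n>0 (size≢0 s))
    0<b : 0 < length B
    0<b = subst (0 <_) (sym (length-word t)) (ℕP.n≢0⇒n>0 (size≢0 t))

  not-once : ∀ e b n π → IsPerm n π → n % 2 ≡ parityOf b → Alternating π → Avoids p132 π →
    ¬ ContainsExactly (tauTo (suc e)) π 1
  not-once e b n π p par alt av c with isPerm-length p
  ... | refl with word-surjective n b π ℕP.≤-refl par p alt (to (avoids⇔no132 π) av)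
  ...   | t , refl = never-one baseCount inversions≢1 (suc e) t (to (contains⇔ b e t 1) c)

theorem3p3 : (k : ℕ) → 3 ≤ k → (τ : Tau) → (ud uu : ℕ → ℕ) →
    (∀ n → HasExactly (λ π → IsPerm n π × UpDown n π × Avoids p132 π ×
    ContainsExactly (tauPattern τ k) π 1) (ud n)) →
    (∀ n → HasExactly (λ π → IsPerm n π × UpUp n π × Avoids p132 π ×
    ContainsExactly (tauPattern τ k) π 1) (uu n)) →
    (∀ n → ((ofℕ ud ⊛ chebW (k ∸ 1)) ⊛ chebW (k ∸ 1)) n
    ≡ mono (+ (2 ^ (2 * (k ∸ 1)))) (suc (2 * (k ∸ 1))) n)
    × (∀ n → ((ofℕ uu ⊛ chebW (k ∸ 1)) ⊛ chebW (k ∸ 1)) n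
    ≡ mono (+ (2 ^ (2 * (k ∸ 1)))) (2 * (k ∸ 1)) n)
    × (∀ n π → IsPerm n π → (UpDown n π ⊎ UpUp n π) → Avoids p132 π →
    ¬ ContainsExactly (p213k k) π 1)
theorem3p3 (suc (suc (suc e))) (s≤s (s≤s (s≤s _))) τ ud uu hud huu =
  proj₁ (parts τ hud huu) , proj₂ (parts τ hud huu) , none
  where
  parts : ∀ τ →
    (∀ n → HasExactly (λ π → IsPerm n π × UpDown n π × Avoids p132 π ×
      ContainsExactly (tauPattern τ (3 + e)) π 1) (ud n)) →
    (∀ n → HasExactly (λ π → IsPerm n π × UpUp n π × Avoids p132 π ×
      ContainsExactly (tauPattern τ (3 + e)) π 1) (uu n)) →
    ((ofℕ ud ⊛ chebW (2 + e)) ⊛ chebW (2 + e) ≈ mono (+ (2 ^ (2 * (2 + e)))) (suc (2 * (2 + e)))) ×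
    ((ofℕ uu ⊛ chebW (2 + e)) ⊛ chebW (2 + e) ≈ mono (+ (2 ^ (2 * (2 + e)))) (2 * (2 + e)))
  -- Each `tauPattern` unfolds to `tauTo (suc e)` for the flags given, and each `refl` evaluates the
  -- number of occurrences of τ in the cherry word 2 3 1 to 1.
  parts τ12  hud huu = ud-series true true refl e ud uu hud huu , uu-series true true refl e ud uu hud huu
  parts τ21  hud huu = ud-series false true refl e ud uu hud huu , uu-series false true refl e ud uu hud huu
  parts τ1-2 hud huu = ud-series true false refl e ud uu hud huu , uu-series true false refl e ud uu hud huu
  none : ∀ n π → IsPerm n π → (UpDown n π ⊎ UpUp n π) → Avoids p132 π → ¬ ContainsExactly (p213k (3 + e)) π 1
  none n π p (inj₁ (_ , par , alt)) = not-once e true n π p par alt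
  none n π p (inj₂ (_ , par , alt)) = not-once e false n π p par alt
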